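{- Let $a\ge b\ge c\ge 1$ be integers with $b$ and $c$ both odd. If the spider $S(a,b,c)$ is $e$-positive, then $a=b+c$. -}

module Defs where

open import Data.Bool.Base using (if_then_else_)
open import Data.Fin.Base using (Fin; zero; suc; toℕ; splitAt)
open import Data.Fin.Patterns using (0F; 1F; 2F)
open import Data.Fin.Properties using (all?)
import Data.Fin.Properties as Fin
open import Data.Integer.Base using (ℤ; +_; 0ℤ; 1ℤ)
import Data.Integer.Base as ℤ
open import Data.List.Base
  using (List; []; _∷_; foldr; map; filter; length; lookup; allFin; upTo; cartesianProductWith)
open import Data.List.Relation.Unary.All using (All)
import Data.List.Relation.Unary.All as All
open import Data.List.Relation.Unary.Linked using (Linked)
open import Data.List.Relation.Unary.Unique.Propositional using (Unique)
open import Data.Nat.Base using (ℕ; zero; suc; _+_; _∸_; _≤_; _≥_)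
open import Data.Nat.ListAction using (sum)
import Data.Nat.Properties as ℕ
open import Data.Product.Base using (_×_; _,_; ∃-syntax)
open import Data.Sum.Base using (_⊎_; [_,_]′; swap)
open import Data.Vec.Base using (Vec; []; _∷_; count)
import Data.Vec.Base as Vec
open import Function.Base using (_∘_)
open import Relation.Binary.Core using (Rel)
open import Relation.Binary.Definitions using (Decidable; Symmetric; Irreflexive)
open import Relation.Binary.PropositionalEquality using (_≡_; _≢_; refl)
open import Relation.Nullary using (¬_; Dec; yes; no; does)
open import Relation.Nullary.Decidable using (¬?; _×-dec_; _→-dec_; _⊎-dec_; map′)
open import Level using (0ℓ)

------------------------------------------------------------------------
-- Formal power series over ℤ in x₀, x₁, x₂, …

-- The list α₀ ∷ … ∷ αₖ₋₁ ∷ [] stands for x₀^α₀ ⋯ xₖ₋₁^αₖ₋₁; all further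
-- exponents are 0.  So lists differing only by trailing zeros denote the same
-- monomial; the series below take equal values on them.
Monomial : Set
Monomial = List ℕ

Series : Set
Series = Monomial → ℤ

infix 4 _≈_
_≈_ : Rel Series 0ℓ
f ≈ g = ∀ α → f α ≡ g α

sumℤ : List ℤ → ℤ
sumℤ = foldr ℤ._+_ 0ℤ

-- All pairs (β , γ) of exponent lists with β + γ = α, entry by entry.
splittings : Monomial → List (Monomial × Monomial)
splittings []      = ([] , []) ∷ []
splittings (a ∷ α) =
  cartesianProductWith (λ i (β , γ) → (i ∷ β) , ((a ∸ i) ∷ γ))
                       (upTo (suc a)) (splittings α)

infixl 7 _⊛_
_⊛_ : Series → Series → Series
(f ⊛ g) α = sumℤ (map (λ (β , γ) → f β ℤ.* g γ) (splittings α))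

-- e k = Σ_{i₁ < … < iₖ} x_{i₁} ⋯ x_{iₖ}: the coefficient is 1 on squarefree
-- monomials of degree k and 0 on all others.
e : ℕ → Series
e k α = if does (All.all? (ℕ._≤? 1) α ×-dec (sum α ℕ.≟ k)) then 1ℤ else 0ℤ

IsPartition : List ℕ → Set
IsPartition μ = Linked _≥_ μ × All (1 ≤_) μ

-- e 0 is the unit series.
eₚ : List ℕ → Series
eₚ = foldr (λ k f → e k ⊛ f) (e 0)

linComb : List (List ℕ) → (List ℕ → ℤ) → Series
linComb Λ c α = sumℤ (map (λ μ → c μ ℤ.* eₚ μ α) Λ)

-- The e_μ form a ℤ-basis of the symmetric functions over ℤ.  The list Λ contains
-- the support of the expansion.
EPositive : Series → Set
EPositive f =
  ∃[ Λ ] ∃[ c ] Unique Λ × All IsPartition Λ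
              × All (λ μ → 0ℤ ℤ.≤ c μ) Λ
              × f ≈ linComb Λ c

------------------------------------------------------------------------
-- Chromatic symmetric functions

record Graph : Set₁ where
  field
    order  : ℕ
    Adj    : Rel (Fin order) 0ℓ
    adj?   : Decidable Adj
    sym    : Symmetric Adj
    irrefl : Irreflexive _≡_ Adj

-- Every function Fin n → Fin k, as a vector, exactly once.
colourings : ∀ k n → List (Vec (Fin k) n)
colourings k zero    = [] ∷ []
colourings k (suc n) = cartesianProductWith _∷_ (allFin k) (colourings k n)

module _ (G : Graph) where
  open Graph G

  Proper : ∀ {k} → Vec (Fin k) order → Set
  Proper κ = ∀ u v → Adj u v → Vec.lookup κ u ≢ Vec.lookup κ v

  proper? : ∀ {k} (κ : Vec (Fin k) order) → Dec (Proper κ)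
  proper? κ = all? λ u → all? λ v →
    adj? u v →-dec ¬? (Vec.lookup κ u Fin.≟ Vec.lookup κ v)

  HasContent : (α : Monomial) → Vec (Fin (length α)) order → Set
  HasContent α κ = ∀ i → count (i Fin.≟_) κ ≡ lookup α i

  hasContent? : ∀ α κ → Dec (HasContent α κ)
  hasContent? α κ = all? λ i → count (i Fin.≟_) κ ℕ.≟ lookup α i

  -- The sum over proper colourings κ of Π_v x_{κ(v)}.  A colouring contributing
  -- to the monomial α uses only the colours below length α.
  chromatic : Series
  chromatic α =
    + length (filter (λ κ → proper? κ ×-dec hasContent? α κ)
                     (colourings (length α) order))

------------------------------------------------------------------------
-- Spiders

-- on ℓ d is the vertex of leg ℓ at distance d + 1 from the centre.
data Site : Set where
  centre : Site
  on     : (ℓ : Fin 3) (d : ℕ) → Site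

data _⋖_ : Rel Site 0ℓ where
  attach : ∀ {ℓ}   → centre ⋖ on ℓ 0
  extend : ∀ {ℓ d} → on ℓ d ⋖ on ℓ (suc d)

_⋖?_ : Decidable _⋖_
_      ⋖? centre       = no λ ()
centre ⋖? on ℓ zero    = yes attach
centre ⋖? on ℓ (suc d) = no λ ()
on ℓ d ⋖? on m zero    = no λ ()
on ℓ d ⋖? on m (suc d′) =
  map′ (λ { (refl , refl) → extend }) (λ { extend → refl , refl })
       ((ℓ Fin.≟ m) ×-dec (d ℕ.≟ d′))

⋖-irrefl : ∀ {s} → ¬ (s ⋖ s)
⋖-irrefl ()

site : ∀ a b c → Fin (suc (a + (b + c))) → Site
site a b c zero    = centre
site a b c (suc v) =
  [ on 0F ∘ toℕ , [ on 1F ∘ toℕ , on 2F ∘ toℕ ]′ ∘ splitAt b ]′ (splitAt a v)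

-- Paths with a, b and c edges glued at a common end vertex.
spider : ℕ → ℕ → ℕ → Graph
spider a b c = record
  { order  = suc (a + (b + c))
  ; Adj    = λ u v → (site a b c u ⋖ site a b c v) ⊎ (site a b c v ⋖ site a b c u)
  ; adj?   = λ u v → (site a b c u ⋖? site a b c v) ⊎-dec (site a b c v ⋖? site a b c u)
  ; sym    = swap
  ; irrefl = λ { refl → [ ⋖-irrefl , ⋖-irrefl ]′ }
  }

{-# OPTIONS --safe #-}
module Submission where

open import Algebra.Bundles using (CommutativeRing)
open import Algebra.Morphism.Structures using (module RingMorphisms)
import Algebra.Properties.CommutativeSemigroup as CommutativeSemigroupProperties
import Algebra.Properties.Group as GroupProperties
import Algebra.Properties.Ring as RingProperties
import Algebra.Properties.Semiring.Sum as Sum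
import Algebra.Solver.Ring.NaturalCoefficients.Default as SemiringSolver
open import Algebra.Structures using (IsCommutativeRing)
open import Data.Bool.Base using (Bool; true; false; if_then_else_; _∧_; not)
open import Data.Bool.Properties using (∧-zeroʳ)
open import Data.Fin.Base using (Fin; zero; suc; toℕ; _↑ˡ_; _↑ʳ_; splitAt)
open import Data.Fin.Patterns using (0F; 1F; 2F)
import Data.Fin.Properties as Fin
open import Data.Integer.Base using (ℤ; +_; 0ℤ; 1ℤ)
import Data.Integer.Base as ℤ
import Data.Integer.Properties as ℤ
open import Data.Integer.Solver using (module +-*-Solver)
open import Data.List.Base
  using (List; []; _∷_; map; foldr; _++_; filter; length; lookup; allFin; tabulate; applyUpTo; upTo; cartesianProductWith)
open import Data.List.Properties using (map-∘)
open import Data.List.Relation.Unary.All using (All)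
import Data.List.Relation.Unary.All as All
open import Data.Nat.Base using (ℕ; zero; suc; _+_; _∸_; _≤_; _<_; _≥_; s≤s; z≤n; parity)
import Data.Nat.Properties as ℕ
open import Data.Parity.Base using (1ℙ)
open import Data.Product.Base using (_×_; _,_; ∃-syntax)
open import Data.Sum.Base using (_⊎_; inj₁; inj₂)
open import Data.Unit.Base using (⊤; tt)
open import Data.Vec.Base using (Vec; []; _∷_; count)
import Data.Vec.Base as Vec
import Data.Vec.Properties as Vec
open import Function.Base using (_∘_)
open import Function.Bundles using (_⇔_; mk⇔)
open import Level using (0ℓ)
open import Relation.Binary.Definitions using (tri<; tri≈; tri>)
open import Relation.Binary.PropositionalEquality using (_≡_; _≢_)
import Relation.Binary.PropositionalEquality as ≡
import Relation.Binary.Reasoning.Setoid as SetoidReasoning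
open import Relation.Nullary using (Dec; yes; no; does; ¬_; contradiction)
open import Relation.Nullary.Decidable using (¬?; _×-dec_; does-⇔; dec-true; dec-false)
open import Defs

-- Let Pₘ be the chromatic symmetric function of the path with m vertices.
-- Expanding along a leg gives
--   S(a, b, c+1) + P_{a+c+1} P_{b+1} = S(a, b+1, c) + P_{a+b+1} P_{c+1},
-- and E P = E + (θE) P, where E = Σ eₖ zᵏ, P = Σ Pₘ zᵐ and θ = z d/dz, writes
-- S(a, b, c) as a polynomial in the eₖ.  These are algebraically independent,
-- so if S(a, b, c) is e-positive, substituting power series in t with
-- nonnegative coefficients for the eₖ gives a series with nonnegative
-- coefficients.  For b and c odd,
--   * if a is odd, e₂ = 1, e₃ = t, eₖ = 0 otherwise has constant term -2;
--   * if a is even, the same substitution has t-coefficient 2(b + c - a) + 1,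
--     which is negative for a > b + c;
--   * if a is even and a < b + c, then a + 1 < b + c, and e_{a+1} = e_{b+c} = t,
--     eₖ = 0 otherwise has t²-coefficient at most -(a + 1 + b + c): no edge of
--     the spider splits it into parts of sizes a + 1 and b + c.

-- Power series over a commutative ring

-- The spider has N = a + b + c + 1 vertices and its function is homogeneous of degree N, so each
-- substitution isolates one coefficient. With e₂ = 1 and e₃ = t the constant term belongs to the
-- partition of N into 2's and the t-coefficient to the one with a single 3; the parity of N decides
-- which exists. With u = a + 1 < v = b + c and u + v = N, only `e_u e_v` contributes to t², since
-- 2u < N < 2v. The obstacle is that e-positivity speaks of coefficient functions in infinitely many
-- variables, where nothing can be substituted for eₖ. Independence is therefore proved in n
-- variables for each n, and n is taken so large that the substituted values vanish beyond n, as the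
-- eₖ in n variables do. The spider and path identities hold for arbitrary weights of the colours.
-- Lifting the condition on one edge adds the colourings in which its ends agree; for two suitable
-- edges these surplus terms coincide and cancel.

record ℤAlgebra : Set₁ where
  field
    commutativeRing : CommutativeRing 0ℓ 0ℓ
  open CommutativeRing commutativeRing public hiding (zero) renaming (_≈_ to _≃_)
  open RingMorphisms ℤ.+-*-rawRing rawRing using (IsRingHomomorphism)
  field
    ι      : ℤ → Carrier
    ι-homo : IsRingHomomorphism ι
  open RingMorphisms.IsRingHomomorphism ι-homo public
    using () renaming (+-homo to ι-+; *-homo to ι-*; 0#-homo to ι-0; 1#-homo to ι-1; -‿homo to ι-neg)
  open GroupProperties +-group public
    using () renaming (∙-cancelʳ to +-cancelʳ)
  open SetoidReasoning setoid public

module PowerSeries (A : ℤAlgebra) where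
  open ℤAlgebra A renaming (_+_ to _⊞_; _*_ to _·_)
  open CommutativeSemigroupProperties +-commutativeSemigroup using (interchange; x∙yz≈y∙xz)

  Seq : Set
  Seq = ℕ → Carrier

  infix 4 _≋_
  _≋_ : Seq → Seq → Set
  f ≋ g = ∀ n → f n ≃ g n

  tail : Seq → Seq
  tail f n = f (suc n)

  const : Carrier → Seq
  const r zero    = r
  const r (suc n) = 0#

  infixl 6 _⊕_
  _⊕_ : Seq → Seq → Seq
  (f ⊕ g) n = f n ⊞ g n

  infixl 7 _⊗_
  -- The Cauchy product, read off from f = f₀ + z · `tail f`; this form needs no bounded summation
  -- index, so the ring laws follow by induction on the degree.
  _⊗_ : Seq → Seq → Seq
  (f ⊗ g) zero    = f 0 · g 0
  (f ⊗ g) (suc n) = f 0 · g (suc n) ⊞ (tail f ⊗ g) n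

  ⊗-cong : ∀ {f f′ g g′} → f ≋ f′ → g ≋ g′ → f ⊗ g ≋ f′ ⊗ g′
  ⊗-cong p q zero    = *-cong (p 0) (q 0)
  ⊗-cong p q (suc n) = +-cong (*-cong (p 0) (q (suc n))) (⊗-cong (λ k → p (suc k)) q n)

  ⊗-zeroˡ : ∀ {f} g → (∀ n → f n ≃ 0#) → ∀ n → (f ⊗ g) n ≃ 0#
  ⊗-zeroˡ g p zero    = trans (*-congʳ (p 0)) (zeroˡ _)
  ⊗-zeroˡ g p (suc n) = begin
    _ ≈⟨ +-cong (*-congʳ (p 0)) (⊗-zeroˡ g (λ k → p (suc k)) n) ⟩
    _ ≈⟨ +-congʳ (zeroˡ _) ⟩
    _ ≈⟨ +-identityˡ _ ⟩
    0# ∎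

  const-⊗ : ∀ r g n → (const r ⊗ g) n ≃ r · g n
  const-⊗ r g zero    = refl
  const-⊗ r g (suc n) = trans (+-congˡ (⊗-zeroˡ g (λ _ → refl) n)) (+-identityʳ _)

  ⊗-distribʳ : ∀ h f g → (f ⊕ g) ⊗ h ≋ (f ⊗ h) ⊕ (g ⊗ h)
  ⊗-distribʳ h f g zero    = distribʳ _ _ _
  ⊗-distribʳ h f g (suc n) =
    trans (+-cong (distribʳ _ _ _) (⊗-distribʳ h (tail f) (tail g) n)) (interchange _ _ _ _)

  -- The mirror image of the defining recursion, peeling the second factor instead; commutativity
  -- follows by comparing the two.
  ⊗-sucʳ : ∀ f g n → (f ⊗ g) (suc n) ≃ f (suc n) · g 0 ⊞ (f ⊗ tail g) n
  ⊗-sucʳ f g zero    = +-comm _ _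
  ⊗-sucʳ f g (suc n) = trans (+-congˡ (⊗-sucʳ (tail f) g n)) (x∙yz≈y∙xz _ _ _)

  ⊗-comm : ∀ f g → f ⊗ g ≋ g ⊗ f
  ⊗-comm f g zero    = *-comm _ _
  ⊗-comm f g (suc n) =
    trans (+-cong (*-comm _ _) (⊗-comm (tail f) g n)) (sym (⊗-sucʳ g f n))

  scale-⊗ : ∀ r f g n → ((λ k → r · f k) ⊗ g) n ≃ r · (f ⊗ g) n
  scale-⊗ r f g zero    = *-assoc _ _ _
  scale-⊗ r f g (suc n) =
    trans (+-cong (*-assoc _ _ _) (scale-⊗ r (tail f) g n)) (sym (distribˡ _ _ _))

  ⊗-assoc : ∀ f g h → (f ⊗ g) ⊗ h ≋ f ⊗ (g ⊗ h)
  ⊗-assoc f g h zero    = *-assoc _ _ _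
  ⊗-assoc f g h (suc n) = begin
    f 0 · g 0 · h (suc n) ⊞ (((λ k → f 0 · g (suc k)) ⊕ (tail f ⊗ g)) ⊗ h) n
      ≈⟨ +-cong (*-assoc _ _ _) (⊗-distribʳ h _ _ n) ⟩
    f 0 · (g 0 · h (suc n)) ⊞ (((λ k → f 0 · g (suc k)) ⊗ h) n ⊞ ((tail f ⊗ g) ⊗ h) n)
      ≈⟨ +-congˡ (+-cong (scale-⊗ (f 0) (tail g) h n) (⊗-assoc (tail f) g h n)) ⟩
    f 0 · (g 0 · h (suc n)) ⊞ (f 0 · (tail g ⊗ h) n ⊞ (tail f ⊗ (g ⊗ h)) n)
      ≈⟨ sym (+-assoc _ _ _) ⟩
    f 0 · (g 0 · h (suc n)) ⊞ f 0 · (tail g ⊗ h) n ⊞ (tail f ⊗ (g ⊗ h)) n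
      ≈⟨ +-congʳ (sym (distribˡ _ _ _)) ⟩
    f 0 · (g ⊗ h) (suc n) ⊞ (tail f ⊗ (g ⊗ h)) n ∎

  ⊗-identityˡ : ∀ f → const 1# ⊗ f ≋ f
  ⊗-identityˡ f n = trans (const-⊗ 1# f n) (*-identityˡ _)

  ⊗-isCommutativeRing : IsCommutativeRing _≋_ _⊕_ _⊗_ (λ f n → - f n) (λ _ → 0#) (const 1#)
  ⊗-isCommutativeRing = record
    { isRing = record
      { +-isAbelianGroup = record
        { isGroup = record
          { isMonoid = record
            { isSemigroup = record
              { isMagma = record
                { isEquivalence = record
                  { refl  = λ _ → refl
                  ; sym   = λ p n → sym (p n)
                  ; trans = λ p q n → trans (p n) (q n)
                  }
                ; ∙-cong = λ p q n → +-cong (p n) (q n)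
                }
              ; assoc = λ _ _ _ _ → +-assoc _ _ _
              }
            ; identity = (λ _ _ → +-identityˡ _) , (λ _ _ → +-identityʳ _)
            }
          ; inverse = (λ _ _ → -‿inverseˡ _) , (λ _ _ → -‿inverseʳ _)
          ; ⁻¹-cong = λ p n → -‿cong (p n)
          }
        ; comm = λ _ _ _ → +-comm _ _
        }
      ; *-cong     = ⊗-cong
      ; *-assoc    = ⊗-assoc
      ; *-identity = ⊗-identityˡ , λ f n → trans (⊗-comm f _ n) (⊗-identityˡ f n)
      ; distrib    =
          (λ f g h n → trans (⊗-comm f _ n) (trans (⊗-distribʳ f g h n) (+-cong (⊗-comm g f n) (⊗-comm h f n))))
        , ⊗-distribʳ
      }
    ; *-comm = ⊗-comm
    }

  const-cong : ∀ {r s} → r ≃ s → const r ≋ const s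
  const-cong p zero    = p
  const-cong p (suc n) = refl

  const-+ : ∀ r s → const (r ⊞ s) ≋ const r ⊕ const s
  const-+ r s zero    = refl
  const-+ r s (suc n) = sym (+-identityˡ _)

  const-* : ∀ r s → const (r · s) ≋ const r ⊗ const s
  const-* r s zero    = refl
  const-* r s (suc n) = sym (trans (const-⊗ r _ (suc n)) (zeroʳ _))

  const-0 : const 0# ≋ (λ _ → 0#)
  const-0 zero    = refl
  const-0 (suc n) = refl

  const-neg : ∀ r → const (- r) ≋ (λ n → - const r n)
  const-neg r zero    = refl
  const-neg r (suc n) = sym (GroupProperties.ε⁻¹≈ε +-group)

  -- Again a `ℤAlgebra`, so that adjoining a variable can be iterated.
  algebra : ℤAlgebra
  algebra = record
    { commutativeRing = record { isCommutativeRing = ⊗-isCommutativeRing }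
    ; ι      = λ z → const (ι z)
    ; ι-homo = record
      { isSemiringHomomorphism = record
        { isNearSemiringHomomorphism = record
          { +-isMonoidHomomorphism = record
            { isMagmaHomomorphism = record
              { isRelHomomorphism = record { cong = λ { _≡_.refl _ → refl } }
              ; homo = λ z w n → trans (const-cong (ι-+ z w) n) (const-+ _ _ n)
              }
            ; ε-homo = λ n → trans (const-cong ι-0 n) (const-0 n)
            }
          ; *-homo = λ z w n → trans (const-cong (ι-* z w) n) (const-* _ _ n)
          }
        ; 1#-homo = const-cong ι-1
        }
      ; -‿homo = λ z n → trans (const-cong (ι-neg z) n) (const-neg _ n)
      }
    }

ℤ-algebra : ℤAlgebra
ℤ-algebra = record
  { commutativeRing = ℤ.+-*-commutativeRing
  ; ι      = λ z → z
  ; ι-homo = record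
    { isSemiringHomomorphism = record
      { isNearSemiringHomomorphism = record
        { +-isMonoidHomomorphism = record
          { isMagmaHomomorphism = record
            { isRelHomomorphism = record { cong = λ p → p }
            ; homo = λ _ _ → _≡_.refl
            }
          ; ε-homo = _≡_.refl
          }
        ; *-homo = λ _ _ → _≡_.refl
        }
      ; 1#-homo = _≡_.refl
      }
    ; -‿homo = λ _ → _≡_.refl
    }
  }

-- Elementary symmetric polynomials and weighted colourings of trees

module Elementary (A : ℤAlgebra) where
  open ℤAlgebra A renaming (_+_ to _⊞_; _*_ to _·_)
  open PowerSeries A
  private
    module 𝔹 = ℤAlgebra algebra
    module ΣB = Sum 𝔹.semiring
    open module ΣA = Sum semiring using (sum)

  -- The series r z. Thus `linear r` is 1 + r z, and `elem x` is the product of the 1 + xᵢ z, whose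
  -- coefficients are the elementary symmetric polynomials.
  shift : Carrier → Seq
  shift r zero    = 0#
  shift r (suc n) = const r n

  linear : Carrier → Seq
  linear r = const 1# ⊕ shift r

  linear-⊗-zero : ∀ r f → (linear r ⊗ f) 0 ≃ f 0
  linear-⊗-zero r f = trans (*-congʳ (+-identityʳ _)) (*-identityˡ _)

  shift-⊗-suc : ∀ r f n → (shift r ⊗ f) (suc n) ≃ r · f n
  shift-⊗-suc r f n = trans (+-cong (zeroˡ _) (const-⊗ r f n)) (+-identityˡ _)

  linear-⊗-suc : ∀ r f n → (linear r ⊗ f) (suc n) ≃ f (suc n) ⊞ r · f n
  linear-⊗-suc r f n = trans (⊗-distribʳ f (const 1#) (shift r) (suc n))
    (+-cong (⊗-identityˡ f (suc n)) (shift-⊗-suc r f n))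

  elem : ∀ {k} → (Fin k → Carrier) → Seq
  elem {zero}  x = const 1#
  elem {suc k} x = linear (x zero) ⊗ elem (x ∘ suc)

  elem-0 : ∀ {k} (x : Fin k → Carrier) → elem x 0 ≃ 1#
  elem-0 {zero}  x = refl
  elem-0 {suc k} x = trans (linear-⊗-zero (x zero) (elem (x ∘ suc))) (elem-0 (x ∘ suc))

  elem-vanish : ∀ {k} (x : Fin k → Carrier) m → elem x (suc (k + m)) ≃ 0#
  elem-vanish {zero}  x m = refl
  elem-vanish {suc k} x m = begin
    elem x (suc (suc (k + m)))
      ≈⟨ linear-⊗-suc _ _ (suc (k + m)) ⟩
    elem (x ∘ suc) (suc (suc (k + m))) ⊞ x zero · elem (x ∘ suc) (suc (k + m))
      ≡⟨ ≡.cong (λ j → elem (x ∘ suc) (suc j) ⊞ x zero · elem (x ∘ suc) (suc (k + m))) (≡.sym (ℕ.+-suc k m)) ⟩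
    elem (x ∘ suc) (suc (k + suc m)) ⊞ x zero · elem (x ∘ suc) (suc (k + m))
      ≈⟨ +-cong (elem-vanish (x ∘ suc) (suc m)) (*-congˡ (elem-vanish (x ∘ suc) m)) ⟩
    0# ⊞ x zero · 0# ≈⟨ trans (+-identityˡ _) (zeroʳ _) ⟩
    0# ∎

  θ : Seq → Seq
  θ f n = ι (+ n) · f n

  ι-suc : ∀ n → ι (+ suc n) ≃ 1# ⊞ ι (+ n)
  ι-suc n = trans (ι-+ (+ 1) (+ n)) (+-congʳ ι-1)

  -- The Leibniz rule, with θ (1 + r z) = r z.
  θ-linear : ∀ r f → θ (linear r ⊗ f) ≋ (shift r ⊗ f) ⊕ (linear r ⊗ θ f)
  θ-linear r f zero = begin
    ι (+ 0) · (linear r ⊗ f) 0        ≈⟨ *-congˡ (linear-⊗-zero r f) ⟩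
    θ f 0                             ≈⟨ linear-⊗-zero r (θ f) ⟨
    (linear r ⊗ θ f) 0                ≈⟨ +-identityˡ _ ⟨
    0# ⊞ (linear r ⊗ θ f) 0           ≈⟨ +-congʳ (zeroˡ _) ⟨
    0# · f 0 ⊞ (linear r ⊗ θ f) 0     ∎
  θ-linear r f (suc n) = begin
    ι (+ suc n) · (linear r ⊗ f) (suc n)
      ≈⟨ *-congˡ (linear-⊗-suc r f n) ⟩
    ι (+ suc n) · (f (suc n) ⊞ r · f n)
      ≈⟨ distribˡ _ _ _ ⟩
    ι (+ suc n) · f (suc n) ⊞ ι (+ suc n) · (r · f n)
      ≈⟨ +-congˡ (*-congʳ (ι-suc n)) ⟩
    ι (+ suc n) · f (suc n) ⊞ (1# ⊞ ι (+ n)) · (r · f n)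
      ≈⟨ solve 4 (λ a i r f → a :+ (con 1 :+ i) :* (r :* f) := r :* f :+ (a :+ r :* (i :* f))) refl _ _ _ _ ⟩
    r · f n ⊞ (θ f (suc n) ⊞ r · θ f n)
      ≈⟨ +-cong (shift-⊗-suc r f n) (linear-⊗-suc r (θ f) n) ⟨
    (shift r ⊗ f) (suc n) ⊞ (linear r ⊗ θ f) (suc n) ∎
    where open SemiringSolver commutativeSemiring

  -- E′/E = Σᵢ xᵢ/(1 + xᵢ z), with the denominators cleared.
  logDerivative : ∀ {k} (x : Fin k → Carrier) (L : Fin k → Seq) (P : Seq) →
    (∀ i → linear (x i) ⊗ L i ≋ P) →
    θ (elem x) ⊗ P ≋ elem x ⊗ ΣB.sum (λ i → shift (x i) ⊗ L i)
  logDerivative {zero} x L P h = 𝔹.trans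
    (⊗-zeroˡ P λ { zero → trans (*-congʳ ι-0) (zeroˡ _) ; (suc n) → zeroʳ _ })
    (𝔹.sym (𝔹.zeroʳ (const 1#)))
  logDerivative {suc k} x L P h = 𝔹.begin
    θ (l ⊗ E) ⊗ P                      𝔹.≈⟨ 𝔹.*-congʳ {P} {θ (l ⊗ E)} {(s ⊗ E) ⊕ (l ⊗ θ E)} (θ-linear (x zero) E) ⟩
    ((s ⊗ E) ⊕ (l ⊗ θ E)) ⊗ P
      𝔹.≈⟨ solve 5 (λ s e l t p → (s :* e :+ l :* t) :* p := (s :* e) :* p :+ l :* (t :* p)) 𝔹.refl s E l (θ E) P ⟩
    ((s ⊗ E) ⊗ P) ⊕ (l ⊗ (θ E ⊗ P))
      𝔹.≈⟨ 𝔹.+-cong (𝔹.*-congˡ {s ⊗ E} (𝔹.sym (h zero))) (𝔹.*-congˡ {l} (logDerivative (x ∘ suc) (L ∘ suc) P (h ∘ suc))) ⟩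
    ((s ⊗ E) ⊗ (l ⊗ L zero)) ⊕ (l ⊗ (E ⊗ R))
      𝔹.≈⟨ solve 5 (λ s e l a r → (s :* e) :* (l :* a) :+ l :* (e :* r) := (l :* e) :* (s :* a :+ r)) 𝔹.refl s E l (L zero) R ⟩
    (l ⊗ E) ⊗ ((s ⊗ L zero) ⊕ R)       𝔹.∎
    where
    open SemiringSolver 𝔹.commutativeSemiring
    s = shift (x zero)
    l = linear (x zero)
    E = elem (x ∘ suc)
    R = ΣB.sum (λ i → shift (x (suc i)) ⊗ L (suc i))

  sum-pointwise : ∀ {k} (t : Fin k → Seq) n → ΣB.sum t n ≃ sum (λ i → t i n)
  sum-pointwise {zero}  t n = refl
  sum-pointwise {suc k} t n = +-congˡ (sum-pointwise (t ∘ suc) n)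

  module Walks {k} (x : Fin k → Carrier) where

    -- The proper colourings of a leg with m vertices hanging from a vertex of
    -- colour i, counted with weights.
    leg : ℕ → Fin k → Carrier
    leg zero    i = 1#
    leg (suc m) i = sum λ j → if does (i Fin.≟ j) then 0# else x j · leg m j

    path : ℕ → Carrier
    path zero    = 1#
    path (suc m) = sum λ j → x j · leg m j

    sum-except : ∀ {k} (y : Fin k → Carrier) i →
      sum (λ j → if does (i Fin.≟ j) then 0# else y j) ⊞ y i ≃ sum y
    sum-except y zero    = trans (+-congʳ (+-identityˡ _)) (+-comm _ _)
    sum-except y (suc i) = trans (+-assoc _ _ _) (+-congˡ (sum-except (y ∘ suc) i))

    -- The edge that attaches the leg forbids exactly the colourings whose first leg vertex has
    -- colour `i`; these weigh `x i · leg m i`.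
    leg-path : ∀ m i → leg (suc m) i ⊞ x i · leg m i ≃ path (suc m)
    leg-path m = sum-except (λ j → x j · leg m j)

    sum-cong : ∀ {s t : Fin k → Carrier} → (∀ i → s i ≃ t i) → sum s ≃ sum t
    sum-cong = ΣA.sum-cong-≋

    linear-leg : ∀ i → linear (x i) ⊗ (λ m → leg m i) ≋ path
    linear-leg i zero    = linear-⊗-zero (x i) (λ m → leg m i)
    linear-leg i (suc m) = trans (linear-⊗-suc (x i) (λ m → leg m i) m) (leg-path m i)

    path-sum : path ≋ const 1# ⊕ ΣB.sum (λ i → shift (x i) ⊗ (λ m → leg m i))
    path-sum zero = sym (trans (+-congˡ (trans (sum-pointwise (λ i → shift (x i) ⊗ (λ m → leg m i)) 0)
      (trans (sum-cong (λ i → zeroˡ 1#)) (ΣA.sum-replicate-zero k)))) (+-identityʳ _))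
    path-sum (suc m) = sym (trans (+-identityˡ _) (trans (sum-pointwise (λ i → shift (x i) ⊗ (λ m → leg m i)) (suc m))
      (sum-cong (λ i → shift-⊗-suc (x i) (λ m → leg m i) m))))

    -- Sorting by the colour of an end vertex gives P = 1 + Σ xᵢ z Lᵢ, and `linear-leg` says Lᵢ = P
    -- / (1 + xᵢ z); so the sum is P times the logarithmic derivative of E.
    elem-⊗-path : elem x ⊗ path ≋ elem x ⊕ (θ (elem x) ⊗ path)
    elem-⊗-path = 𝔹.begin
      E ⊗ path                      𝔹.≈⟨ 𝔹.*-congˡ {E} path-sum ⟩
      E ⊗ (const 1# ⊕ R)            𝔹.≈⟨ 𝔹.distribˡ E (const 1#) R ⟩
      (E ⊗ const 1#) ⊕ (E ⊗ R)      𝔹.≈⟨ 𝔹.+-cong (𝔹.*-identityʳ E) (𝔹.sym (logDerivative x (λ i m → leg m i) path linear-leg)) ⟩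
      E ⊕ (θ E ⊗ path)              𝔹.∎
      where
      E = elem x
      R = ΣB.sum (λ i → shift (x i) ⊗ (λ m → leg m i))

    -- In degree m + 1 of E P = E + (θE) P, the term eₖ Pₘ₊₁₋ₖ with k ≥ 1 occurs once on the left
    -- and k times on the right. Cancelling leaves the factor k - 1, which is `j`.
    path-rec : ∀ m → path (suc m) ≃ elem x (suc m) ⊞ ((λ j → ι (+ j) · elem x (suc j)) ⊗ path) m
    path-rec m = +-cancelʳ ((tail E ⊗ path) m) _ _ (begin
      path (suc m) ⊞ (tail E ⊗ path) m
        ≈⟨ +-congʳ (trans (*-congʳ (elem-0 x)) (*-identityˡ _)) ⟨
      E 0 · path (suc m) ⊞ (tail E ⊗ path) m
        ≈⟨ elem-⊗-path (suc m) ⟩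
      E (suc m) ⊞ (θ E 0 · path (suc m) ⊞ (tail (θ E) ⊗ path) m)
        ≈⟨ +-congˡ (trans (+-congʳ (trans (*-congʳ (trans (*-congʳ ι-0) (zeroˡ _))) (zeroˡ _))) (+-identityˡ _)) ⟩
      E (suc m) ⊞ (tail (θ E) ⊗ path) m
        ≈⟨ +-congˡ (⊗-cong {g = path} (λ j → trans (*-congʳ (ι-suc j))
             (trans (distribʳ _ _ _) (trans (+-congʳ (*-identityˡ _)) (+-comm _ _)))) (λ _ → refl) m) ⟩
      E (suc m) ⊞ ((F ⊕ tail E) ⊗ path) m
        ≈⟨ +-congˡ (⊗-distribʳ path F (tail E) m) ⟩
      E (suc m) ⊞ ((F ⊗ path) m ⊞ (tail E ⊗ path) m)
        ≈⟨ +-assoc _ _ _ ⟨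
      E (suc m) ⊞ (F ⊗ path) m ⊞ (tail E ⊗ path) m ∎)
      where
      E F : Seq
      E = elem x
      F j = ι (+ j) · elem x (suc j)

    star : ℕ → ℕ → ℕ → Carrier
    star a b c = sum λ i → x i · (leg a i · (leg b i · leg c i))

    private
      -- A path with a + b + 1 vertices, its colourings sorted by the colour of the vertex where the
      -- two legs meet.
      bend : ℕ → ℕ → Carrier
      bend a b = sum λ i → x i · (leg a i · leg b i)

      -- Here `y i` plays the role of the weight of a tree whose root has colour `i`. Joining a path
      -- to the root by an edge loses, compared with the disjoint union, the colourings in which the
      -- two ends of that edge agree; they form the second sum.
      sum-path : ∀ m (y : Fin k → Carrier) →
        sum (λ i → y i · leg (suc m) i) ⊞ sum (λ i → y i · (x i · leg m i)) ≃ sum y · path (suc m)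
      sum-path m y = begin
        sum (λ i → y i · leg (suc m) i) ⊞ sum (λ i → y i · (x i · leg m i))
          ≈⟨ ΣA.∑-distrib-+ (λ i → y i · leg (suc m) i) (λ i → y i · (x i · leg m i)) ⟨
        sum (λ i → y i · leg (suc m) i ⊞ y i · (x i · leg m i))
          ≈⟨ sum-cong (λ i → trans (sym (distribˡ _ _ _)) (*-congˡ (leg-path m i))) ⟩
        sum (λ i → y i · path (suc m))
          ≈⟨ ΣA.*-distribʳ-sum (path (suc m)) y ⟨
        sum y · path (suc m) ∎

      open SemiringSolver commutativeSemiring

      bend-suc : ∀ a b → bend a (suc b) ⊞ sum (λ i → x i · (x i · (leg a i · leg b i))) ≃ path (suc a) · path (suc b)
      bend-suc a b = trans
        (+-cong (sum-cong (λ i → sym (*-assoc _ _ _)))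
          (sum-cong (λ i → solve 3 (λ x a b → x :* (x :* (a :* b)) := x :* a :* (x :* b)) refl _ _ _)))
        (sum-path b (λ i → x i · leg a i))

      bend-comm : ∀ a b → bend a b ≃ bend b a
      bend-comm a b = sum-cong (λ i → *-congˡ (*-comm _ _))

      -- In `bend-suc` both the surplus sum and the product of paths are symmetric in `a` and `b`,
      -- so the remaining term is symmetric too.
      bend-shift : ∀ a b → bend a (suc b) ≃ bend (suc a) b
      bend-shift a b = +-cancelʳ (sum (λ i → x i · (x i · (leg a i · leg b i)))) _ _ (begin
        bend a (suc b) ⊞ sum (λ i → x i · (x i · (leg a i · leg b i))) ≈⟨ bend-suc a b ⟩
        path (suc a) · path (suc b)                                    ≈⟨ *-comm _ _ ⟩
        path (suc b) · path (suc a)                                    ≈⟨ bend-suc b a ⟨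
        bend b (suc a) ⊞ sum (λ i → x i · (x i · (leg b i · leg a i)))
          ≈⟨ +-cong (bend-comm b (suc a)) (sum-cong (λ i → *-congˡ (*-congˡ (*-comm _ _)))) ⟩
        bend (suc a) b ⊞ sum (λ i → x i · (x i · (leg a i · leg b i))) ∎)

      bend-path : ∀ a b → bend a b ≃ path (suc (a + b))
      bend-path a zero = begin
        bend a 0            ≈⟨ sum-cong (λ i → *-congˡ (*-identityʳ _)) ⟩
        path (suc a)        ≡⟨ ≡.cong (λ j → path (suc j)) (≡.sym (ℕ.+-identityʳ a)) ⟩
        path (suc (a + 0))  ∎
      bend-path a (suc b) = begin
        bend a (suc b)          ≈⟨ bend-shift a b ⟩
        bend (suc a) b          ≈⟨ bend-path (suc a) b ⟩
        path (suc (suc a + b))  ≡⟨ ≡.cong (λ j → path (suc j)) (≡.sym (ℕ.+-suc a b)) ⟩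
        path (suc (a + suc b))  ∎

      star-suc : ∀ a b c →
        star a b (suc c) ⊞ sum (λ i → x i · (x i · (leg a i · (leg b i · leg c i)))) ≃
        path (suc (a + b)) · path (suc c)
      star-suc a b c = trans
        (+-cong (sum-cong (λ i → solve 4 (λ x a b c → x :* (a :* (b :* c)) := x :* (a :* b) :* c) refl _ _ _ _))
          (sum-cong (λ i → solve 4 (λ x a b c → x :* (x :* (a :* (b :* c))) := x :* (a :* b) :* (x :* c)) refl _ _ _ _)))
        (trans (sum-path c (λ i → x i · (leg a i · leg b i))) (*-congʳ (bend-path a b)))

    star-swap : ∀ a b c → star a b c ≃ star a c b
    star-swap a b c = sum-cong (λ i → *-congˡ (*-congˡ (*-comm _ _)))

    star-0 : ∀ a b → star a b 0 ≃ path (suc (a + b))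
    star-0 a b = trans (sum-cong (λ i → *-congˡ (*-congˡ (*-identityʳ _)))) (bend-path a b)

    -- Detaching the third leg from S(a, b, c+1) and the second from S(a, b+1, c) leaves the same
    -- surplus sum, in which the legs have lengths `a`, `b`, `c`. The two instances of `star-suc`
    -- eliminate it.
    star-rec : ∀ a b c →
      star a b (suc c) ⊞ path (suc (a + c)) · path (suc b) ≃
      star a (suc b) c ⊞ path (suc (a + b)) · path (suc c)
    star-rec a b c = begin
      star a b (suc c) ⊞ path (suc (a + c)) · path (suc b)
        ≈⟨ +-congˡ (star-suc a c b) ⟨
      star a b (suc c) ⊞ (star a c (suc b) ⊞ sum (λ i → x i · (x i · (leg a i · (leg c i · leg b i)))))
        ≈⟨ +-congˡ (+-cong (star-swap a c (suc b)) (sum-cong (λ i → *-congˡ (*-congˡ (*-congˡ (*-comm _ _)))))) ⟩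
      star a b (suc c) ⊞ (star a (suc b) c ⊞ sum (λ i → x i · (x i · (leg a i · (leg b i · leg c i)))))
        ≈⟨ solve 3 (λ s t d → s :+ (t :+ d) := t :+ (s :+ d)) refl _ _ _ ⟩
      star a (suc b) c ⊞ (star a b (suc c) ⊞ sum (λ i → x i · (x i · (leg a i · (leg b i · leg c i)))))
        ≈⟨ +-congˡ (star-suc a b c) ⟩
      star a (suc b) c ⊞ path (suc (a + b)) · path (suc c) ∎

-- Algebraic independence of the elementary symmetric functions

infixl 6 _⊹_
infixl 7 _∗_
-- Polynomials in the eₖ as syntax, so that one and the same expression can be evaluated at the
-- elementary symmetric polynomials and at the values of a substitution.
data Expr : Set where
  con     : ℤ → Expr
  var     : ℕ → Expr
  _⊹_ _∗_ : Expr → Expr → Expr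
  neg     : Expr → Expr

-- Polynomials in y₁, …, yₙ: the coefficients with respect to yₙ, lowest first.
Poly : ℕ → Set
Poly zero    = ℤ
Poly (suc n) = List (Poly n)

conᴾ : ∀ n → ℤ → Poly n
conᴾ zero    z = z
conᴾ (suc n) z = conᴾ n z ∷ []

-- Index 0 gives 1 and an index above `n` gives 0, in agreement with the elementary symmetric
-- polynomials in `n` variables.
varᴾ : ∀ n → ℕ → Poly n
varᴾ n       zero    = conᴾ n 1ℤ
varᴾ zero    (suc k) = 0ℤ
varᴾ (suc n) (suc k) with k ℕ.≟ n
... | yes _ = conᴾ n 0ℤ ∷ conᴾ n 1ℤ ∷ []
... | no  _ = varᴾ n (suc k) ∷ []

addᴾ : ∀ n → Poly n → Poly n → Poly n
addᴾ zero    p        q        = p ℤ.+ q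
addᴾ (suc n) []       qs       = qs
addᴾ (suc n) (p ∷ ps) []       = p ∷ ps
addᴾ (suc n) (p ∷ ps) (q ∷ qs) = addᴾ n p q ∷ addᴾ (suc n) ps qs

mulᴾ : ∀ n → Poly n → Poly n → Poly n
mulᴾ zero    p        q  = p ℤ.* q
mulᴾ (suc n) []       qs = []
mulᴾ (suc n) (p ∷ ps) qs = addᴾ (suc n) (map (mulᴾ n p) qs) (conᴾ n 0ℤ ∷ mulᴾ (suc n) ps qs)

negᴾ : ∀ n → Poly n → Poly n
negᴾ zero    p  = ℤ.- p
negᴾ (suc n) ps = map (negᴾ n) ps

normalise : ∀ n → Expr → Poly n
normalise n (con z) = conᴾ n z
normalise n (var k) = varᴾ n k
normalise n (s ⊹ t) = addᴾ n (normalise n s) (normalise n t)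
normalise n (s ∗ t) = mulᴾ n (normalise n s) (normalise n t)
normalise n (neg t) = negᴾ n (normalise n t)

module Evaluation (A : ℤAlgebra) (ε : ℕ → ℤAlgebra.Carrier A) where
  open ℤAlgebra A renaming (_+_ to _⊞_; _*_ to _·_)
  open CommutativeSemigroupProperties +-commutativeSemigroup using (interchange)
  open SemiringSolver commutativeSemiring using (solve; _:+_; _:*_; _:=_) renaming (con to :con)

  eval : Expr → Carrier
  eval (con z) = ι z
  eval (var k) = ε k
  eval (s ⊹ t) = eval s ⊞ eval t
  eval (s ∗ t) = eval s · eval t
  eval (neg t) = - eval t

  evalᴾ : ∀ n → Poly n → Carrier
  evalᴾ zero    z        = ι z
  evalᴾ (suc n) []       = 0#
  evalᴾ (suc n) (p ∷ ps) = evalᴾ n p ⊞ ε (suc n) · evalᴾ (suc n) ps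

  evalᴾ-singleton : ∀ n p → evalᴾ (suc n) (p ∷ []) ≃ evalᴾ n p
  evalᴾ-singleton n p = trans (+-congˡ (zeroʳ _)) (+-identityʳ _)

  evalᴾ-con : ∀ n z → evalᴾ n (conᴾ n z) ≃ ι z
  evalᴾ-con zero    z = refl
  evalᴾ-con (suc n) z = trans (evalᴾ-singleton n _) (evalᴾ-con n z)

  evalᴾ-add : ∀ n p q → evalᴾ n (addᴾ n p q) ≃ evalᴾ n p ⊞ evalᴾ n q
  evalᴾ-add zero    p        q        = ι-+ p q
  evalᴾ-add (suc n) []       qs       = sym (+-identityˡ _)
  evalᴾ-add (suc n) (p ∷ ps) []       = sym (+-identityʳ _)
  evalᴾ-add (suc n) (p ∷ ps) (q ∷ qs) = begin
    evalᴾ n (addᴾ n p q) ⊞ y · evalᴾ (suc n) (addᴾ (suc n) ps qs)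
      ≈⟨ +-cong (evalᴾ-add n p q) (*-congˡ (evalᴾ-add (suc n) ps qs)) ⟩
    (evalᴾ n p ⊞ evalᴾ n q) ⊞ y · (evalᴾ (suc n) ps ⊞ evalᴾ (suc n) qs)
      ≈⟨ +-congˡ (distribˡ _ _ _) ⟩
    (evalᴾ n p ⊞ evalᴾ n q) ⊞ (y · evalᴾ (suc n) ps ⊞ y · evalᴾ (suc n) qs)
      ≈⟨ interchange _ _ _ _ ⟩
    evalᴾ (suc n) (p ∷ ps) ⊞ evalᴾ (suc n) (q ∷ qs) ∎
    where y = ε (suc n)

  -- General enough to serve products by a coefficient as well as negation, where `c` is -1.
  evalᴾ-map : ∀ n (f : Poly n → Poly n) c → (∀ q → evalᴾ n (f q) ≃ c · evalᴾ n q) →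
    ∀ qs → evalᴾ (suc n) (map f qs) ≃ c · evalᴾ (suc n) qs
  evalᴾ-map n f c h []       = sym (zeroʳ c)
  evalᴾ-map n f c h (q ∷ qs) = trans (+-cong (h q) (*-congˡ (evalᴾ-map n f c h qs)))
    (solve 4 (λ c q y r → c :* q :+ y :* (c :* r) := c :* (q :+ y :* r)) refl _ _ _ _)

  evalᴾ-mul : ∀ n p q → evalᴾ n (mulᴾ n p q) ≃ evalᴾ n p · evalᴾ n q
  evalᴾ-mul zero    p        q  = ι-* p q
  evalᴾ-mul (suc n) []       qs = sym (zeroˡ _)
  evalᴾ-mul (suc n) (p ∷ ps) qs = begin
    evalᴾ (suc n) (addᴾ (suc n) (map (mulᴾ n p) qs) (conᴾ n 0ℤ ∷ mulᴾ (suc n) ps qs))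
      ≈⟨ evalᴾ-add (suc n) (map (mulᴾ n p) qs) (conᴾ n 0ℤ ∷ mulᴾ (suc n) ps qs) ⟩
    evalᴾ (suc n) (map (mulᴾ n p) qs) ⊞ (evalᴾ n (conᴾ n 0ℤ) ⊞ y · evalᴾ (suc n) (mulᴾ (suc n) ps qs))
      ≈⟨ +-cong (evalᴾ-map n (mulᴾ n p) (evalᴾ n p) (evalᴾ-mul n p) qs)
           (+-cong (trans (evalᴾ-con n 0ℤ) ι-0) (*-congˡ (evalᴾ-mul (suc n) ps qs))) ⟩
    evalᴾ n p · Q ⊞ (0# ⊞ y · (evalᴾ (suc n) ps · Q))
      ≈⟨ solve 4 (λ p q y r → p :* q :+ (:con 0 :+ y :* (r :* q)) := (p :+ y :* r) :* q) refl _ _ _ _ ⟩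
    evalᴾ (suc n) (p ∷ ps) · Q ∎
    where
    y = ε (suc n)
    Q = evalᴾ (suc n) qs

  evalᴾ-neg : ∀ n p → evalᴾ n (negᴾ n p) ≃ - evalᴾ n p
  evalᴾ-neg zero    p  = ι-neg p
  evalᴾ-neg (suc n) ps = trans
    (evalᴾ-map n (negᴾ n) (- 1#) (λ q → trans (evalᴾ-neg n q) (sym (-1*x≈-x _))) ps) (-1*x≈-x _)
    where open RingProperties ring using (-1*x≈-x)

  module _ (ε-0 : ε 0 ≃ 1#) where

    evalᴾ-var : ∀ n k → (n < k → ε k ≃ 0#) → evalᴾ n (varᴾ n k) ≃ ε k
    evalᴾ-var n       zero    v = trans (evalᴾ-con n 1ℤ) (trans ι-1 (sym ε-0))
    evalᴾ-var zero    (suc k) v = trans ι-0 (sym (v (s≤s z≤n)))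
    evalᴾ-var (suc n) (suc k) v with k ℕ.≟ n
    ... | yes ≡.refl = trans
      (+-cong (trans (evalᴾ-con n 0ℤ) ι-0)
        (*-congˡ (trans (evalᴾ-singleton n (conᴾ n 1ℤ)) (trans (evalᴾ-con n 1ℤ) ι-1))))
      (trans (+-identityˡ _) (*-identityʳ _))
    ... | no k≢n = trans (evalᴾ-singleton n (varᴾ n (suc k)))
      (evalᴾ-var n (suc k) λ n<1+k → v (s≤s (ℕ.≤∧≢⇒< (ℕ.≤-pred n<1+k) (k≢n ∘ ≡.sym))))

    evalᴾ-normalise : ∀ n → (∀ k → n < k → ε k ≃ 0#) → ∀ t → evalᴾ n (normalise n t) ≃ eval t
    evalᴾ-normalise n v (con z) = evalᴾ-con n z
    evalᴾ-normalise n v (var k) = evalᴾ-var n k (v k)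
    evalᴾ-normalise n v (s ⊹ t) = trans (evalᴾ-add n (normalise n s) (normalise n t))
      (+-cong (evalᴾ-normalise n v s) (evalᴾ-normalise n v t))
    evalᴾ-normalise n v (s ∗ t) = trans (evalᴾ-mul n (normalise n s) (normalise n t))
      (*-cong (evalᴾ-normalise n v s) (evalᴾ-normalise n v t))
    evalᴾ-normalise n v (neg t) = trans (evalᴾ-neg n (normalise n t)) (-‿cong (evalᴾ-normalise n v t))

-- The ring of power series over ℤ in x₀, ..., xₙ₋₁. The outermost variable is x₀, matching the head
-- of an exponent list, so inductions peel off x₀.
powerSeries : ℕ → ℤAlgebra
powerSeries zero    = ℤ-algebra
powerSeries (suc n) = PowerSeries.algebra (powerSeries n)

module Constants (A : ℤAlgebra) where
  open ℤAlgebra A using (Carrier)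
  open PowerSeries A using (const; const-+; const-*)
  private
    module E = Elementary A
    module Eᴮ = Elementary (PowerSeries.algebra A)
    module B = ℤAlgebra (PowerSeries.algebra A)

  elem-const : ∀ {k} (x : Fin k → Carrier) m → Eᴮ.elem (const ∘ x) m B.≃ const (E.elem x m)
  elem-const {zero}  x zero    = B.refl
  elem-const {zero}  x (suc m) = B.sym (PowerSeries.const-0 A)
  elem-const {suc k} x zero    = B.trans (Eᴮ.linear-⊗-zero (const (x zero)) (Eᴮ.elem (const ∘ x ∘ suc)))
    (B.trans (elem-const (x ∘ suc) 0)
      (PowerSeries.const-cong A (ℤAlgebra.sym A (E.linear-⊗-zero (x zero) (E.elem (x ∘ suc))))))
  elem-const {suc k} x (suc m) = B.begin
    Eᴮ.elem (const ∘ x) (suc m)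
      B.≈⟨ Eᴮ.linear-⊗-suc (const (x zero)) (Eᴮ.elem (const ∘ x ∘ suc)) m ⟩
    Eᴮ.elem (const ∘ x ∘ suc) (suc m) B.+ const (x zero) B.* Eᴮ.elem (const ∘ x ∘ suc) m
      B.≈⟨ B.+-cong (elem-const (x ∘ suc) (suc m)) (B.*-congˡ {const (x zero)} (elem-const (x ∘ suc) m)) ⟩
    const e₁ B.+ const (x zero) B.* const e₀
      B.≈⟨ B.+-congˡ {const e₁} (const-* (x zero) e₀) ⟨
    const e₁ B.+ const (x zero A.* e₀)
      B.≈⟨ const-+ e₁ (x zero A.* e₀) ⟨
    const (e₁ A.+ x zero A.* e₀)
      B.≈⟨ PowerSeries.const-cong A (E.linear-⊗-suc (x zero) (E.elem (x ∘ suc)) m) ⟨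
    const (E.elem x (suc m)) B.∎
    where
    module A = ℤAlgebra A
    e₀ = E.elem (x ∘ suc) m
    e₁ = E.elem (x ∘ suc) (suc m)

generic : ∀ n → Fin n → ℤAlgebra.Carrier (powerSeries n)
generic (suc n) zero    = Elementary.shift (powerSeries n) (ℤAlgebra.1# (powerSeries n))
generic (suc n) (suc i) = PowerSeries.const (powerSeries n) (generic n i)

genericElem : ∀ n → ℕ → ℤAlgebra.Carrier (powerSeries n)
genericElem n = Elementary.elem (powerSeries n) (generic n)

module GenericElem (n : ℕ) where
  private module A = ℤAlgebra (powerSeries n)
  private module B = ℤAlgebra (powerSeries (suc n))
  open PowerSeries (powerSeries n)
  open Elementary (powerSeries n)
  private module Eᴮ = Elementary (powerSeries (suc n))
  private module C = Constants (powerSeries n)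

  genericElem-0 : genericElem (suc n) 0 ≋ const A.1#
  genericElem-0 = Eᴮ.elem-0 (generic (suc n))

  -- Squarefree monomials are sorted by whether they contain x₀.
  genericElem-suc : ∀ k → genericElem (suc n) (suc k) ≋ const (genericElem n (suc k)) ⊕ shift (genericElem n k)
  genericElem-suc k = B.trans
    (Eᴮ.linear-⊗-suc (generic (suc n) zero) (Eᴮ.elem (const ∘ generic n)) k)
    (B.+-cong (C.elem-const (generic n) (suc k))
      (B.trans (B.*-congˡ {generic (suc n) zero} (C.elem-const (generic n) k)) shift-const))
    where
    shift-const : shift A.1# ⊗ const (genericElem n k) ≋ shift (genericElem n k)
    shift-const zero    = A.zeroˡ _
    shift-const (suc m) = A.trans (shift-⊗-suc A.1# (const (genericElem n k)) m) (A.*-identityˡ _)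

  genericElem-at-0 : ∀ k → genericElem (suc n) k 0 A.≃ genericElem n k
  genericElem-at-0 zero    = A.trans (genericElem-0 0) (A.sym (elem-0 (generic n)))
  genericElem-at-0 (suc k) = A.trans (genericElem-suc k 0) (A.+-identityʳ _)

  genericElem-vanish : A._≃_ (genericElem n (suc n)) A.0#
  genericElem-vanish = ≡.subst (λ j → genericElem n (suc j) A.≃ A.0#) (ℕ.+-identityʳ n) (elem-vanish (generic n) 0)

  genericElem-top : genericElem (suc n) (suc n) ≋ shift (genericElem n n)
  genericElem-top zero    = A.trans (genericElem-at-0 (suc n)) genericElem-vanish
  genericElem-top (suc m) = A.trans (genericElem-suc n (suc m)) (A.+-identityˡ _)

-- In n variables eₙ is the product of all of them. Its factor x₀ merely shifts coefficients, so
-- every x₀-coefficient of `r` is annihilated by the product of the other variables, and induction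
-- applies.
genericElem-regular : ∀ n r → let open ℤAlgebra (powerSeries n) in genericElem n n * r ≃ 0# → r ≃ 0#
genericElem-regular zero    r p = ≡.trans (≡.sym (ℤAlgebra.*-identityˡ ℤ-algebra r)) p
genericElem-regular (suc n) r p m = genericElem-regular n (r m) (begin
  genericElem n n * r m                         ≈⟨ shift-⊗-suc (genericElem n n) r m ⟨
  (shift (genericElem n n) ⊗ r) (suc m)         ≈⟨ ⊗-cong {g = r} genericElem-top (λ _ → refl) (suc m) ⟨
  (genericElem (suc n) (suc n) ⊗ r) (suc m)     ≈⟨ p (suc m) ⟩
  0#                                            ∎)
  where
  open ℤAlgebra (powerSeries n)
  open PowerSeries (powerSeries n)
  open Elementary (powerSeries n)
  open GenericElem n

genericEvalᴾ : ∀ n m → Poly m → ℤAlgebra.Carrier (powerSeries n)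
genericEvalᴾ n = Evaluation.evalᴾ (powerSeries n) (genericElem n)

genericEvalᴾ-at-0 : ∀ n m p → let open ℤAlgebra (powerSeries n) in genericEvalᴾ (suc n) m p 0 ≃ genericEvalᴾ n m p
genericEvalᴾ-at-0 n zero    z        = ℤAlgebra.refl (powerSeries n)
genericEvalᴾ-at-0 n (suc m) []       = ℤAlgebra.refl (powerSeries n)
genericEvalᴾ-at-0 n (suc m) (p ∷ ps) = +-cong (genericEvalᴾ-at-0 n m p)
  (*-cong (GenericElem.genericElem-at-0 n (suc m)) (genericEvalᴾ-at-0 n (suc m) ps))
  where open ℤAlgebra (powerSeries n)

-- Setting the first variable to 0 kills eₙ₊₁ and maps the lower eₖ to the
-- eₖ in one variable fewer, so the lowest coefficient vanishes; then cancel
-- the regular element eₙ₊₁ = x₀ ⋯ xₙ.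
independence : ∀ n p → ℤAlgebra._≃_ (powerSeries n) (genericEvalᴾ n n p) (ℤAlgebra.0# (powerSeries n)) →
  (A : ℤAlgebra) (ε : ℕ → ℤAlgebra.Carrier A) →
  ℤAlgebra._≃_ A (Evaluation.evalᴾ A ε n p) (ℤAlgebra.0# A)
independence zero z h A ε = trans (reflexive (≡.cong ι h)) ι-0
  where open ℤAlgebra A
independence (suc n) []       h A ε = ℤAlgebra.refl A
independence (suc n) (p ∷ ps) h A ε =
  trans (+-cong (independence n p p≈0 A ε) (*-congˡ (independence (suc n) ps ps≈0 A ε)))
    (trans (+-identityˡ _) (zeroʳ _))
  where
  open ℤAlgebra A
  module R = ℤAlgebra (powerSeries n)
  module R′ = ℤAlgebra (powerSeries (suc n))

  p≈0 : genericEvalᴾ n n p R.≃ R.0#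
  p≈0 = R.begin
    genericEvalᴾ n n p
      R.≈⟨ genericEvalᴾ-at-0 n n p ⟨
    genericEvalᴾ (suc n) n p 0
      R.≈⟨ R.+-identityʳ _ ⟨
    genericEvalᴾ (suc n) n p 0 R.+ R.0#
      R.≈⟨ R.+-congˡ (R.trans (R.*-congʳ (GenericElem.genericElem-top n 0)) (R.zeroˡ _)) ⟨
    genericEvalᴾ (suc n) (suc n) (p ∷ ps) 0
      R.≈⟨ h 0 ⟩
    R.0# R.∎

  -- The induction hypothesis makes `p` vanish at every point of every algebra, in particular at the
  -- elementary symmetric polynomials in n + 1 variables. What is left of the hypothesis is eₙ₊₁
  -- times the value of `ps`.
  ps≈0 : genericEvalᴾ (suc n) (suc n) ps R′.≃ R′.0#
  ps≈0 = genericElem-regular (suc n) S (R′.begin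
    E R′.* S                              R′.≈⟨ R′.+-identityˡ (E R′.* S) ⟨
    R′.0# R′.+ E R′.* S
      R′.≈⟨ R′.+-congʳ {E R′.* S} (independence n p p≈0 (powerSeries (suc n)) (genericElem (suc n))) ⟨
    genericEvalᴾ (suc n) (suc n) (p ∷ ps) R′.≈⟨ h ⟩
    R′.0#                                 R′.∎)
    where
    S = genericEvalᴾ (suc n) (suc n) ps
    E = genericElem (suc n) (suc n)

-- Evaluation at such an `ε` factors through the normal form in y₁, ..., yₙ, to which `independence`
-- applies. The two conditions on `ε` are those that the eₖ in n variables satisfy.
transfer : ∀ n t →
  ℤAlgebra._≃_ (powerSeries n) (Evaluation.eval (powerSeries n) (genericElem n) t) (ℤAlgebra.0# (powerSeries n)) →
  (A : ℤAlgebra) (let open ℤAlgebra A) (ε : ℕ → Carrier) → ε 0 ≃ 1# → (∀ k → n < k → ε k ≃ 0#) →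
  Evaluation.eval A ε t ≃ 0#
transfer n t h A ε ε-0 v = trans (sym (Evaluation.evalᴾ-normalise A ε ε-0 n v t))
  (independence n (normalise n t) (R.trans (Evaluation.evalᴾ-normalise (powerSeries n) (genericElem n) (elem-0 (generic n)) n vanish t) h) A ε)
  where
  open ℤAlgebra A
  module R = ℤAlgebra (powerSeries n)
  open Elementary (powerSeries n)
  vanish : ∀ k → n < k → genericElem n k R.≃ R.0#
  vanish k n<k with ℕ.m≤n⇒∃[o]m+o≡n n<k
  ... | o , ≡.refl = elem-vanish (generic n) o

-- Coefficients of series

-- Sets xᵢ = 0 for i ≥ n: only exponent lists of length n are read.
embed : ∀ n → Series → ℤAlgebra.Carrier (powerSeries n)
embed zero    f   = f []
embed (suc n) f a = embed n (λ α → f (a ∷ α))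

embed-cong : ∀ n {f g} → f ≈ g → ℤAlgebra._≃_ (powerSeries n) (embed n f) (embed n g)
embed-cong zero    p   = p []
embed-cong (suc n) p a = embed-cong n (λ α → p (a ∷ α))

embed-+ : ∀ n f g → let open ℤAlgebra (powerSeries n) using (_≃_) renaming (_+_ to _⊞_) in
  embed n (λ α → f α ℤ.+ g α) ≃ (embed n f ⊞ embed n g)
embed-+ zero    f g   = ≡.refl
embed-+ (suc n) f g a = embed-+ n (λ α → f (a ∷ α)) (λ α → g (a ∷ α))

embed-0 : ∀ n → ℤAlgebra._≃_ (powerSeries n) (embed n (λ _ → 0ℤ)) (ℤAlgebra.0# (powerSeries n))
embed-0 zero      = ≡.refl
embed-0 (suc n) a = embed-0 n

embed-scale : ∀ n z f → let open ℤAlgebra (powerSeries n) using (ι; _≃_) renaming (_*_ to _·_) in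
  embed n (λ α → z ℤ.* f α) ≃ (ι z · embed n f)
embed-scale zero    z f   = ≡.refl
embed-scale (suc n) z f a = trans (embed-scale n z (λ α → f (a ∷ α)))
  (sym (PowerSeries.const-⊗ (powerSeries n) (ι z) (embed (suc n) f) a))
  where open ℤAlgebra (powerSeries n)

module ListSum (A : ℤAlgebra) where
  open ℤAlgebra A renaming (_+_ to _⊞_; _*_ to _·_)

  ∑ : ∀ {X : Set} → (X → Carrier) → List X → Carrier
  ∑ f xs = foldr _⊞_ 0# (map f xs)

  ∑-cong : ∀ {X : Set} {f g : X → Carrier} → (∀ x → f x ≃ g x) → ∀ xs → ∑ f xs ≃ ∑ g xs
  ∑-cong p []       = refl
  ∑-cong p (x ∷ xs) = +-cong (p x) (∑-cong p xs)

  ∑-++ : ∀ {X : Set} (f : X → Carrier) xs ys → ∑ f (xs ++ ys) ≃ ∑ f xs ⊞ ∑ f ys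
  ∑-++ f []       ys = sym (+-identityˡ _)
  ∑-++ f (x ∷ xs) ys = trans (+-congˡ (∑-++ f xs ys)) (sym (+-assoc _ _ _))

  ∑-0 : ∀ {X : Set} (xs : List X) → ∑ (λ _ → 0#) xs ≃ 0#
  ∑-0 []       = refl
  ∑-0 (x ∷ xs) = trans (+-identityˡ _) (∑-0 xs)

  ∑-*ˡ : ∀ {X : Set} c (f : X → Carrier) xs → ∑ (λ x → c · f x) xs ≃ c · ∑ f xs
  ∑-*ˡ c f []       = sym (zeroʳ c)
  ∑-*ˡ c f (x ∷ xs) = trans (+-congˡ (∑-*ˡ c f xs)) (sym (distribˡ _ _ _))

  ∑-*ʳ : ∀ {X : Set} c (f : X → Carrier) xs → ∑ (λ x → f x · c) xs ≃ ∑ f xs · c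
  ∑-*ʳ c f []       = sym (zeroˡ c)
  ∑-*ʳ c f (x ∷ xs) = trans (+-congˡ (∑-*ʳ c f xs)) (sym (distribʳ _ _ _))

  ∑-cartesian : ∀ {X Y Z : Set} (g : Z → Carrier) (f : X → Y → Z) xs ys →
    ∑ g (cartesianProductWith f xs ys) ≃ ∑ (λ x → ∑ (λ y → g (f x y)) ys) xs
  ∑-cartesian g f []       ys = refl
  ∑-cartesian g f (x ∷ xs) ys = trans (∑-++ g (map (f x) ys) _)
    (+-cong (reflexive (≡.cong (foldr _⊞_ 0#) (≡.sym (map-∘ ys)))) (∑-cartesian g f xs ys))

  ∑-tabulate : ∀ {X : Set} {k} (g : X → Carrier) (f : Fin k → X) → ∑ g (tabulate f) ≡ Sum.sum semiring (g ∘ f)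
  ∑-tabulate {k = zero}  g f = ≡.refl
  ∑-tabulate {k = suc k} g f = ≡.cong (g (f zero) ⊞_) (∑-tabulate g (f ∘ suc))

open ListSum ℤ-algebra using () renaming (∑-cartesian to ∑ℤ-cartesian; ∑-cong to ∑ℤ-cong)

-- A sum over i + j = n in the recursive shape of `_⊗_`, the bridge from the `upTo` sums of
-- `splittings` to iterated Cauchy products.
antidiagonal : (ℕ → ℕ → ℤ) → ℕ → ℤ
antidiagonal h zero    = h 0 0
antidiagonal h (suc n) = h 0 (suc n) ℤ.+ antidiagonal (λ i → h (suc i)) n

antidiagonal-upTo : ∀ (h : ℕ → ℕ → ℤ) n → sumℤ (map (λ i → h i (n ∸ i)) (upTo (suc n))) ≡ antidiagonal h n
antidiagonal-upTo h n = ≡.trans (map-applyUpTo (λ i → h i (n ∸ i)) (λ i → i) (suc n)) (go h n)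
  where
  map-applyUpTo : ∀ (g : ℕ → ℤ) f m → sumℤ (map g (applyUpTo f m)) ≡ sumℤ (applyUpTo (g ∘ f) m)
  map-applyUpTo g f zero    = ≡.refl
  map-applyUpTo g f (suc m) = ≡.cong (ℤ._+_ (g (f 0))) (map-applyUpTo g (f ∘ suc) m)

  go : ∀ (h : ℕ → ℕ → ℤ) n → sumℤ (applyUpTo (λ i → h i (n ∸ i)) (suc n)) ≡ antidiagonal h n
  go h zero    = ℤ.+-identityʳ _
  go h (suc n) = ≡.cong (ℤ._+_ (h 0 (suc n))) (go (λ i → h (suc i)) n)

⊛-cons : ∀ f g a α → (f ⊛ g) (a ∷ α) ≡ antidiagonal (λ i j → ((f ∘ (i ∷_)) ⊛ (g ∘ (j ∷_))) α) a
⊛-cons f g a α = ≡.trans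
  (∑ℤ-cartesian (λ (β , γ) → f β ℤ.* g γ) (λ i (β , γ) → (i ∷ β) , ((a ∸ i) ∷ γ)) (upTo (suc a)) (splittings α))
  (antidiagonal-upTo (λ i j → ((f ∘ (i ∷_)) ⊛ (g ∘ (j ∷_))) α) a)

embed-⊛ : ∀ n f g → let open ℤAlgebra (powerSeries n) using (_≃_) renaming (_*_ to _·_) in
  embed n (f ⊛ g) ≃ (embed n f · embed n g)
embed-⊛ zero    f g   = ℤ.+-identityʳ _
embed-⊛ (suc n) f g a = trans (embed-cong n (⊛-cons f g a)) (go (λ i → f ∘ (i ∷_)) (λ i → g ∘ (i ∷_)) a)
  where
  open ℤAlgebra (powerSeries n)
  open PowerSeries (powerSeries n)
  go : ∀ (F G : ℕ → Series) a →
    embed n (λ α → antidiagonal (λ i j → (F i ⊛ G j) α) a) ≃ ((λ i → embed n (F i)) ⊗ (λ j → embed n (G j))) a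
  go F G zero    = embed-⊛ n (F 0) (G 0)
  go F G (suc a) = trans (embed-+ n _ _) (+-cong (embed-⊛ n (F 0) (G (suc a))) (go (F ∘ suc) G a))

-- By the exponent of x₀: 0 keeps the degree `k`, 1 lowers it by one, and anything larger is not
-- squarefree. These are the coefficients in `genericElem-suc`.
embed-e : ∀ n k → ℤAlgebra._≃_ (powerSeries n) (embed n (e k)) (genericElem n k)
embed-e zero    zero    = ≡.refl
embed-e zero    (suc k) = ≡.refl
embed-e (suc n) k zero = trans (embed-e n k) (sym (GenericElem.genericElem-at-0 n k))
  where open ℤAlgebra (powerSeries n)
embed-e (suc n) zero (suc zero) =
  trans (embed-cong n (λ α → ≡.cong (if_then 1ℤ else 0ℤ) (∧-zeroʳ (does (All.all? (ℕ._≤? 1) α)))))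
    (trans (embed-0 n) (sym (GenericElem.genericElem-0 n 1)))
  where open ℤAlgebra (powerSeries n)
embed-e (suc n) (suc k) (suc zero) =
  trans (embed-e n k) (sym (trans (GenericElem.genericElem-suc n k 1) (+-identityˡ _)))
  where open ℤAlgebra (powerSeries n)
embed-e (suc n) zero (suc (suc a)) = trans (embed-0 n) (sym (GenericElem.genericElem-0 n (suc (suc a))))
  where open ℤAlgebra (powerSeries n)
embed-e (suc n) (suc k) (suc (suc a)) =
  trans (embed-0 n) (sym (trans (GenericElem.genericElem-suc n k (suc (suc a))) (+-identityˡ _)))
  where open ℤAlgebra (powerSeries n)

monomialExpr : List ℕ → Expr
monomialExpr = foldr (λ k t → var k ∗ t) (var 0)

linCombExpr : List (List ℕ) → (List ℕ → ℤ) → Expr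
linCombExpr Λ c = foldr (λ μ t → con (c μ) ∗ monomialExpr μ ⊹ t) (con 0ℤ) Λ

module _ (n : ℕ) where
  open ℤAlgebra (powerSeries n)
  open Evaluation (powerSeries n) (genericElem n)

  embed-eₚ : ∀ μ → embed n (eₚ μ) ≃ eval (monomialExpr μ)
  embed-eₚ []      = embed-e n 0
  embed-eₚ (k ∷ μ) = trans (embed-⊛ n (e k) (eₚ μ)) (*-cong (embed-e n k) (embed-eₚ μ))

  embed-linComb : ∀ Λ c → embed n (linComb Λ c) ≃ eval (linCombExpr Λ c)
  embed-linComb []      c = trans (embed-0 n) (sym ι-0)
  embed-linComb (μ ∷ Λ) c = trans (embed-+ n (λ α → c μ ℤ.* eₚ μ α) (linComb Λ c))
    (+-cong (trans (embed-scale n (c μ) (eₚ μ)) (*-congˡ (embed-eₚ μ))) (embed-linComb Λ c))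

-- Extraction of coefficients from iterated power series

coeff : ∀ n → ℤAlgebra.Carrier (powerSeries n) → (Fin n → ℕ) → ℤ
coeff zero    z a = z
coeff (suc n) f a = coeff n (f (a zero)) (a ∘ suc)

coeff-embed : ∀ f α → coeff (length α) (embed (length α) f) (lookup α) ≡ f α
coeff-embed f []      = ≡.refl
coeff-embed f (a ∷ α) = coeff-embed (λ β → f (a ∷ β)) α

-- Exponent lists come in all lengths, hence families over all `n`; fixing the exponent of x₀ turns
-- a family into a shifted one.
coeff-injective : ∀ (r s : ∀ n → ℤAlgebra.Carrier (powerSeries n)) →
  (∀ α → coeff (length α) (r (length α)) (lookup α) ≡ coeff (length α) (s (length α)) (lookup α)) →
  ∀ n → ℤAlgebra._≃_ (powerSeries n) (r n) (s n)
coeff-injective r s p zero      = p []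
coeff-injective r s p (suc n) a = coeff-injective (λ m → r (suc m) a) (λ m → s (suc m) a) (λ α → p (a ∷ α)) n

coeff-cong : ∀ n {r s} {a b : Fin n → ℕ} → ℤAlgebra._≃_ (powerSeries n) r s → (∀ i → a i ≡ b i) →
  coeff n r a ≡ coeff n s b
coeff-cong zero    p q = p
coeff-cong (suc n) {r} {b = b} p q = coeff-cong n (trans (reflexive (≡.cong r (q zero))) (p (b zero))) (q ∘ suc)
  where open ℤAlgebra (powerSeries n)

coeff-0 : ∀ n a → coeff n (ℤAlgebra.0# (powerSeries n)) a ≡ 0ℤ
coeff-0 zero    a = ≡.refl
coeff-0 (suc n) a = coeff-0 n (a ∘ suc)

coeff-+ : ∀ n r s a → coeff n (ℤAlgebra._+_ (powerSeries n) r s) a ≡ coeff n r a ℤ.+ coeff n s a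
coeff-+ zero    r s a = ≡.refl
coeff-+ (suc n) r s a = coeff-+ n (r (a zero)) (s (a zero)) (a ∘ suc)

coeff-∑ : ∀ n {X : Set} (g : X → ℤAlgebra.Carrier (powerSeries n)) xs a →
  coeff n (ListSum.∑ (powerSeries n) g xs) a ≡ sumℤ (map (λ x → coeff n (g x) a) xs)
coeff-∑ n g []       a = coeff-0 n a
coeff-∑ n g (x ∷ xs) a = ≡.trans (coeff-+ n (g x) _ a) (≡.cong (ℤ._+_ (coeff n (g x) a)) (coeff-∑ n g xs a))

coeff-1-zero : ∀ n {a : Fin n → ℕ} → (∀ i → 0 ≡ a i) → coeff n (ℤAlgebra.1# (powerSeries n)) a ≡ 1ℤ
coeff-1-zero zero    p = ≡.refl
coeff-1-zero (suc n) {a} p with a zero | p zero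
... | .0 | ≡.refl = coeff-1-zero n (p ∘ suc)

coeff-1-nonzero : ∀ n {a : Fin n → ℕ} → ¬ (∀ i → 0 ≡ a i) → coeff n (ℤAlgebra.1# (powerSeries n)) a ≡ 0ℤ
coeff-1-nonzero zero    p = contradiction (λ ()) p
coeff-1-nonzero (suc n) {a} p with a zero in eq
... | zero  = coeff-1-nonzero n (λ q → p λ { zero → ≡.sym eq ; (suc i) → q i })
... | suc m = coeff-0 n (a ∘ suc)

coeff-generic-zero : ∀ n j r a → a j ≡ 0 → coeff n (ℤAlgebra._*_ (powerSeries n) (generic n j) r) a ≡ 0ℤ
coeff-generic-zero (suc n) zero r a p = ≡.trans
  (coeff-cong n (trans (reflexive (≡.cong (generic (suc n) zero ⊗ r) p)) (zeroˡ _)) (λ _ → ≡.refl))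
  (coeff-0 n (a ∘ suc))
  where
  open ℤAlgebra (powerSeries n)
  open PowerSeries (powerSeries n)
coeff-generic-zero (suc n) (suc j) r a p = ≡.trans
  (coeff-cong n (PowerSeries.const-⊗ (powerSeries n) (generic n j) r (a zero)) (λ _ → ≡.refl))
  (coeff-generic-zero n j (r (a zero)) (a ∘ suc) p)

-- Multiplication by xⱼ raises one exponent by one. The lowered exponents `b` are characterised by
-- equations, which avoids truncated subtraction.
coeff-generic-suc : ∀ n j r a b → a j ≡ suc (b j) → (∀ i → i ≢ j → a i ≡ b i) →
  coeff n (ℤAlgebra._*_ (powerSeries n) (generic n j) r) a ≡ coeff n r b
coeff-generic-suc (suc n) zero r a b p q =
  coeff-cong n (trans (reflexive (≡.cong (generic (suc n) zero ⊗ r) p))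
    (trans (shift-⊗-suc 1# r (b zero)) (*-identityˡ _))) (λ i → q (suc i) λ ())
  where
  open ℤAlgebra (powerSeries n)
  open PowerSeries (powerSeries n)
  open Elementary (powerSeries n)
coeff-generic-suc (suc n) (suc j) r a b p q = ≡.trans
  (coeff-cong n (trans (PowerSeries.const-⊗ (powerSeries n) (generic n j) r (a zero))
    (*-congˡ (reflexive (≡.cong r (q zero λ ()))))) (λ _ → ≡.refl))
  (coeff-generic-suc n j (r (b zero)) (a ∘ suc) (b ∘ suc) p (λ i i≢j → q (suc i) (i≢j ∘ Fin.suc-injective)))
  where open ℤAlgebra (powerSeries n)

-- Colourings of spiders

module ColouringSum (A : ℤAlgebra) {k : ℕ} (x : Fin k → ℤAlgebra.Carrier A) where
  open ℤAlgebra A renaming (_+_ to _⊞_; _*_ to _·_)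
  open ListSum A

  weight : ∀ {n} → Vec (Fin k) n → Carrier
  weight []      = 1#
  weight (j ∷ κ) = x j · weight κ

  weight-++ : ∀ {m n} (κ : Vec (Fin k) m) (κ′ : Vec (Fin k) n) → weight (κ Vec.++ κ′) ≃ weight κ · weight κ′
  weight-++ []      κ′ = sym (*-identityˡ _)
  weight-++ (j ∷ κ) κ′ = trans (*-congˡ (weight-++ κ κ′)) (sym (*-assoc _ _ _))

  guard : Bool → Carrier → Carrier
  guard b w = if b then w else 0#

  guard-cong : ∀ b {v w} → v ≃ w → guard b v ≃ guard b w
  guard-cong true  p = p
  guard-cong false p = refl

  guard-∧ : ∀ b c v w → guard (b ∧ c) (v · w) ≃ guard b v · guard c w
  guard-∧ true  true  v w = refl
  guard-∧ true  false v w = sym (zeroʳ v)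
  guard-∧ false c     v w = sym (zeroˡ _)

  ∑-colourings-++ : ∀ m n (g : Vec (Fin k) (m + n) → Carrier) →
    ∑ g (colourings k (m + n)) ≃ ∑ (λ κ → ∑ (λ κ′ → g (κ Vec.++ κ′)) (colourings k n)) (colourings k m)
  ∑-colourings-++ zero    n g = sym (+-identityʳ _)
  ∑-colourings-++ (suc m) n g = begin
    ∑ g (cartesianProductWith _∷_ (allFin k) (colourings k (m + n)))
      ≈⟨ ∑-cartesian g _∷_ (allFin k) (colourings k (m + n)) ⟩
    ∑ (λ j → ∑ (λ κ → g (j ∷ κ)) (colourings k (m + n))) (allFin k)
      ≈⟨ ∑-cong (λ j → ∑-colourings-++ m n (λ κ → g (j ∷ κ))) (allFin k) ⟩
    ∑ (λ j → ∑ (λ κ → ∑ (λ κ′ → g (j ∷ κ Vec.++ κ′)) (colourings k n)) (colourings k m)) (allFin k)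
      ≈⟨ ∑-cartesian (λ κ → ∑ (λ κ′ → g (κ Vec.++ κ′)) (colourings k n)) _∷_ (allFin k) (colourings k m) ⟨
    ∑ (λ κ → ∑ (λ κ′ → g (κ Vec.++ κ′)) (colourings k n)) (colourings k (suc m)) ∎

  ∑-allFin : ∀ (g : Fin k → Carrier) → ∑ g (allFin k) ≃ Sum.sum semiring g
  ∑-allFin g = reflexive (∑-tabulate g (λ i → i))

  ∑-product : ∀ {X Y : Set} (f : X → Carrier) (g : Y → Carrier) xs ys →
    ∑ (λ u → ∑ (λ v → f u · g v) ys) xs ≃ ∑ f xs · ∑ g ys
  ∑-product f g xs ys = trans (∑-cong (λ u → ∑-*ˡ (f u) g ys) xs) (∑-*ʳ (∑ g ys) f xs)

ProperLeg : ∀ {k n} → Fin k → Vec (Fin k) n → Set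
ProperLeg i []      = ⊤
ProperLeg i (j ∷ κ) = i ≢ j × ProperLeg j κ

properLeg? : ∀ {k n} (i : Fin k) (κ : Vec (Fin k) n) → Dec (ProperLeg i κ)
properLeg? i []      = yes tt
properLeg? i (j ∷ κ) = ¬? (i Fin.≟ j) ×-dec properLeg? j κ

module _ {k : ℕ} where

  properLeg⇒consecutive : ∀ {n} {i : Fin k} {κ : Vec (Fin k) n} → ProperLeg i κ →
    ∀ d d′ → toℕ d′ ≡ suc (toℕ d) → Vec.lookup (i ∷ κ) d ≢ Vec.lookup (i ∷ κ) d′
  properLeg⇒consecutive {κ = j ∷ κ} (i≢j , p) zero    (suc zero)     eq = i≢j
  properLeg⇒consecutive {κ = j ∷ κ} (i≢j , p) (suc d) (suc d′) eq =
    properLeg⇒consecutive p d d′ (ℕ.suc-injective eq)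

  consecutive⇒properLeg : ∀ {n} {i : Fin k} (κ : Vec (Fin k) n) →
    (∀ d d′ → toℕ d′ ≡ suc (toℕ d) → Vec.lookup (i ∷ κ) d ≢ Vec.lookup (i ∷ κ) d′) → ProperLeg i κ
  consecutive⇒properLeg []      h = tt
  consecutive⇒properLeg (j ∷ κ) h = h zero (suc zero) ≡.refl ,
    consecutive⇒properLeg κ (λ d d′ eq → h (suc d) (suc d′) (≡.cong suc eq))

  module _ {a b c : ℕ} (i : Fin k) (κa : Vec (Fin k) a) (κb : Vec (Fin k) b) (κc : Vec (Fin k) c) where
    private
      κ : Vec (Fin k) (suc (a + (b + c)))
      κ = i ∷ κa Vec.++ (κb Vec.++ κc)

      size : Fin 3 → ℕ
      size 0F = a
      size 1F = b
      size 2F = c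

      onLeg : ∀ ℓ → Vec (Fin k) (size ℓ)
      onLeg 0F = κa
      onLeg 1F = κb
      onLeg 2F = κc

      -- Links sites to colours without vertex numbers, so that the nested `splitAt` in `site` is
      -- analysed only in `colourAt` and `vertexAt`.
      data Coloured : Site → Fin k → Set where
        centre : Coloured centre i
        on     : ∀ ℓ d {m} → toℕ d ≡ m → Coloured (on ℓ m) (Vec.lookup (onLeg ℓ) d)

      colourAt : ∀ v → Coloured (site a b c v) (Vec.lookup κ v)
      colourAt zero = centre
      colourAt (suc v) with splitAt a v in eq
      ... | inj₁ d rewrite ≡.sym (Fin.splitAt⁻¹-↑ˡ {a} {b + c} {v} {d} eq) | Vec.lookup-++ˡ κa (κb Vec.++ κc) d = on 0F d ≡.refl
      ... | inj₂ w with splitAt b w in eq′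
      ... | inj₁ d rewrite ≡.sym (Fin.splitAt⁻¹-↑ʳ {a} {b + c} {v} {w} eq) | Vec.lookup-++ʳ κa (κb Vec.++ κc) w
                         | ≡.sym (Fin.splitAt⁻¹-↑ˡ {b} {c} {w} {d} eq′) | Vec.lookup-++ˡ κb κc d = on 1F d ≡.refl
      ... | inj₂ d rewrite ≡.sym (Fin.splitAt⁻¹-↑ʳ {a} {b + c} {v} {w} eq) | Vec.lookup-++ʳ κa (κb Vec.++ κc) w
                         | ≡.sym (Fin.splitAt⁻¹-↑ʳ {b} {c} {w} {d} eq′) | Vec.lookup-++ʳ κb κc d = on 2F d ≡.refl

      vertexAt : ∀ {s j} → Coloured s j → ∃[ v ] site a b c v ≡ s × Vec.lookup κ v ≡ j
      vertexAt centre = zero , ≡.refl , ≡.refl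
      vertexAt (on 0F d ≡.refl) = suc (d ↑ˡ (b + c)) , site≡ , Vec.lookup-++ˡ κa (κb Vec.++ κc) d
        where
        site≡ : site a b c (suc (d ↑ˡ (b + c))) ≡ on 0F (toℕ d)
        site≡ rewrite Fin.splitAt-↑ˡ a d (b + c) = ≡.refl
      vertexAt (on 1F d ≡.refl) = suc (a ↑ʳ (d ↑ˡ c)) , site≡ ,
        ≡.trans (Vec.lookup-++ʳ κa (κb Vec.++ κc) (d ↑ˡ c)) (Vec.lookup-++ˡ κb κc d)
        where
        site≡ : site a b c (suc (a ↑ʳ (d ↑ˡ c))) ≡ on 1F (toℕ d)
        site≡ rewrite Fin.splitAt-↑ʳ a (b + c) (d ↑ˡ c) | Fin.splitAt-↑ˡ b d c = ≡.refl
      vertexAt (on 2F d ≡.refl) = suc (a ↑ʳ (b ↑ʳ d)) , site≡ ,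
        ≡.trans (Vec.lookup-++ʳ κa (κb Vec.++ κc) (b ↑ʳ d)) (Vec.lookup-++ʳ κb κc d)
        where
        site≡ : site a b c (suc (a ↑ʳ (b ↑ʳ d))) ≡ on 2F (toℕ d)
        site≡ rewrite Fin.splitAt-↑ʳ a (b + c) (b ↑ʳ d) | Fin.splitAt-↑ʳ b c d = ≡.refl

      ProperLegs : Set
      ProperLegs = ProperLeg i κa × ProperLeg i κb × ProperLeg i κc

      legs : ProperLegs → ∀ ℓ → ProperLeg i (onLeg ℓ)
      legs (pa , pb , pc) 0F = pa
      legs (pa , pb , pc) 1F = pb
      legs (pa , pb , pc) 2F = pc

      separated : ProperLegs → ∀ {s t j j′} → s ⋖ t → Coloured s j → Coloured t j′ → j ≢ j′
      separated p attach centre (on ℓ d eq) =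
        properLeg⇒consecutive (legs p ℓ) zero (suc d) (≡.cong suc eq)
      separated p extend (on ℓ d ≡.refl) (on .ℓ d′ eq) =
        properLeg⇒consecutive (legs p ℓ) (suc d) (suc d′) (≡.cong suc eq)

      legProper : Proper (spider a b c) κ → ∀ ℓ → ProperLeg i (onLeg ℓ)
      legProper p ℓ = consecutive⇒properLeg (onLeg ℓ) consecutive
        where
        apart : ∀ {s t j j′} → s ⋖ t → Coloured s j → Coloured t j′ → j ≢ j′
        apart s⋖t u v with vertexAt u | vertexAt v
        ... | u′ , ≡.refl , ≡.refl | v′ , ≡.refl , ≡.refl = p u′ v′ (inj₁ s⋖t)

        consecutive : ∀ d d′ → toℕ d′ ≡ suc (toℕ d) →
          Vec.lookup (i ∷ onLeg ℓ) d ≢ Vec.lookup (i ∷ onLeg ℓ) d′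
        consecutive zero    (suc d′) eq = apart attach centre (on ℓ d′ (ℕ.suc-injective eq))
        consecutive (suc d) (suc d′) eq = apart extend (on ℓ d ≡.refl) (on ℓ d′ (ℕ.suc-injective eq))

    -- Every edge joins consecutive entries of the list formed by the centre and one leg.
    proper⇔legs : Proper (spider a b c) κ ⇔ ProperLegs
    proper⇔legs = mk⇔
      (λ p → legProper p 0F , legProper p 1F , legProper p 2F)
      λ { p u v (inj₁ u⋖v) → separated p u⋖v (colourAt u) (colourAt v)
        ; p u v (inj₂ v⋖u) → separated p v⋖u (colourAt v) (colourAt u) ∘ ≡.sym }

module SpiderSum (A : ℤAlgebra) {k : ℕ} (x : Fin k → ℤAlgebra.Carrier A) where
  open ℤAlgebra A renaming (_+_ to _⊞_; _*_ to _·_)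
  open ListSum A
  open Elementary.Walks A x
  open ColouringSum A x

  private
    legWeight : Fin k → ∀ {n} → Vec (Fin k) n → Carrier
    legWeight i κ = guard (does (properLeg? i κ)) (weight κ)

  ∑-leg : ∀ m i → ∑ (legWeight i) (colourings k m) ≃ leg m i
  ∑-leg zero    i = +-identityʳ _
  ∑-leg (suc m) i = begin
    ∑ (legWeight i) (colourings k (suc m))
      ≈⟨ ∑-cartesian (legWeight i) _∷_ (allFin k) (colourings k m) ⟩
    ∑ (λ j → ∑ (λ κ → legWeight i (j ∷ κ)) (colourings k m)) (allFin k)
      ≈⟨ ∑-cong (λ j → step j (does (i Fin.≟ j))) (allFin k) ⟩
    ∑ (λ j → if does (i Fin.≟ j) then 0# else x j · leg m j) (allFin k)
      ≈⟨ ∑-allFin (λ j → if does (i Fin.≟ j) then 0# else x j · leg m j) ⟩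
    leg (suc m) i ∎
    where
    step : ∀ j b → ∑ (λ κ → guard (not b ∧ does (properLeg? j κ)) (x j · weight κ)) (colourings k m)
      ≃ (if b then 0# else x j · leg m j)
    step j true  = ∑-0 (colourings k m)
    step j false = trans (∑-cong (λ κ → guard-∧ true (does (properLeg? j κ)) (x j) (weight κ)) (colourings k m))
      (trans (∑-*ˡ (x j) (legWeight j) (colourings k m)) (*-congˡ (∑-leg m j)))

  ∑-spider : ∀ a b c →
    ∑ (λ κ → guard (does (proper? (spider a b c) κ)) (weight κ)) (colourings k (suc (a + (b + c)))) ≃ star a b c
  ∑-spider a b c = begin
    ∑ F (colourings k (suc (a + (b + c))))
      ≈⟨ ∑-cartesian F _∷_ (allFin k) (colourings k (a + (b + c))) ⟩
    ∑ (λ i → ∑ (λ κ → F (i ∷ κ)) (colourings k (a + (b + c)))) (allFin k)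
      ≈⟨ ∑-cong centred (allFin k) ⟩
    ∑ (λ i → x i · (leg a i · (leg b i · leg c i))) (allFin k)
      ≈⟨ ∑-allFin (λ i → x i · (leg a i · (leg b i · leg c i))) ⟩
    star a b c ∎
    where
    F : Vec (Fin k) (suc (a + (b + c))) → Carrier
    F κ = guard (does (proper? (spider a b c) κ)) (weight κ)

    split : ∀ i (κa : Vec (Fin k) a) (κb : Vec (Fin k) b) (κc : Vec (Fin k) c) →
      F (i ∷ κa Vec.++ (κb Vec.++ κc)) ≃ (x i · legWeight i κa) · (legWeight i κb · legWeight i κc)
    split i κa κb κc = begin
      F (i ∷ κa Vec.++ (κb Vec.++ κc))
        -- Equivalent propositions have equal decisions, so the test for properness becomes a
        -- conjunction of tests on the legs and the guarded weight factorises.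
        ≡⟨ ≡.cong (λ t → guard t (weight (i ∷ κa Vec.++ (κb Vec.++ κc))))
             (does-⇔ (proper⇔legs i κa κb κc) (proper? (spider a b c) (i ∷ κa Vec.++ (κb Vec.++ κc)))
               (properLeg? i κa ×-dec (properLeg? i κb ×-dec properLeg? i κc))) ⟩
      guard (pa ∧ (pb ∧ pc)) (x i · weight (κa Vec.++ (κb Vec.++ κc)))
        ≈⟨ guard-cong (pa ∧ (pb ∧ pc)) (*-congˡ (trans (weight-++ κa (κb Vec.++ κc)) (*-congˡ (weight-++ κb κc)))) ⟩
      guard (pa ∧ (pb ∧ pc)) (x i · (weight κa · (weight κb · weight κc)))
        ≈⟨ guard-∧ true (pa ∧ (pb ∧ pc)) (x i) _ ⟩
      x i · guard (pa ∧ (pb ∧ pc)) (weight κa · (weight κb · weight κc))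
        ≈⟨ *-congˡ (trans (guard-∧ pa (pb ∧ pc) _ _) (*-congˡ (guard-∧ pb pc _ _))) ⟩
      x i · (legWeight i κa · (legWeight i κb · legWeight i κc))
        ≈⟨ *-assoc _ _ _ ⟨
      (x i · legWeight i κa) · (legWeight i κb · legWeight i κc) ∎
      where
      pa = does (properLeg? i κa)
      pb = does (properLeg? i κb)
      pc = does (properLeg? i κc)

    centred : ∀ i → ∑ (λ κ → F (i ∷ κ)) (colourings k (a + (b + c))) ≃ x i · (leg a i · (leg b i · leg c i))
    centred i = begin
      ∑ (λ κ → F (i ∷ κ)) (colourings k (a + (b + c)))
        ≈⟨ ∑-colourings-++ a (b + c) (λ κ → F (i ∷ κ)) ⟩
      ∑ (λ κa → ∑ (λ κ → F (i ∷ κa Vec.++ κ)) (colourings k (b + c))) (colourings k a)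
        ≈⟨ ∑-cong (λ κa → trans (∑-colourings-++ b c (λ κ → F (i ∷ κa Vec.++ κ)))
             (trans (∑-cong (λ κb → trans (∑-cong (λ κc → split i κa κb κc) (colourings k c))
                      (∑-*ˡ (x i · legWeight i κa) (λ κc → legWeight i κb · legWeight i κc) (colourings k c))) (colourings k b))
               (trans (∑-*ˡ (x i · legWeight i κa) (λ κb → ∑ (λ κc → legWeight i κb · legWeight i κc) (colourings k c)) (colourings k b))
                 (*-congˡ (∑-product (legWeight i) (legWeight i) (colourings k b) (colourings k c))))))
             (colourings k a) ⟩
      ∑ (λ κa → (x i · legWeight i κa) · (∑ (legWeight i) (colourings k b) · ∑ (legWeight i) (colourings k c))) (colourings k a)
        ≈⟨ ∑-*ʳ _ (λ κa → x i · legWeight i κa) (colourings k a) ⟩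
      ∑ (λ κa → x i · legWeight i κa) (colourings k a) · (∑ (legWeight i) (colourings k b) · ∑ (legWeight i) (colourings k c))
        ≈⟨ *-congʳ (∑-*ˡ (x i) (legWeight i) (colourings k a)) ⟩
      x i · ∑ (legWeight i) (colourings k a) · (∑ (legWeight i) (colourings k b) · ∑ (legWeight i) (colourings k c))
        ≈⟨ *-cong (*-congˡ (∑-leg a i)) (*-cong (∑-leg b i) (∑-leg c i)) ⟩
      x i · leg a i · (leg b i · leg c i)
        ≈⟨ *-assoc _ _ _ ⟩
      x i · (leg a i · (leg b i · leg c i)) ∎

module _ {n : ℕ} where
  open ColouringSum (powerSeries n) (generic n)

  content : ∀ {m} → Vec (Fin n) m → Fin n → ℕ
  content κ i = count (i Fin.≟_) κ

  content-∷-≡ : ∀ {m} j (κ : Vec (Fin n) m) → content (j ∷ κ) j ≡ suc (content κ j)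
  content-∷-≡ j κ rewrite dec-true (j Fin.≟ j) ≡.refl = ≡.refl

  content-∷-≢ : ∀ {m} j (κ : Vec (Fin n) m) i → i ≢ j → content (j ∷ κ) i ≡ content κ i
  content-∷-≢ j κ i i≢j rewrite dec-false (i Fin.≟ j) i≢j = ≡.refl

  coeff-weight-yes : ∀ {m} (κ : Vec (Fin n) m) a → (∀ i → content κ i ≡ a i) → coeff n (weight κ) a ≡ 1ℤ
  coeff-weight-yes []      a p = coeff-1-zero n p
  coeff-weight-yes (j ∷ κ) a p = ≡.trans
    (coeff-generic-suc n j (weight κ) a (content κ) (≡.trans (≡.sym (p j)) (content-∷-≡ j κ))
      (λ i i≢j → ≡.trans (≡.sym (p i)) (content-∷-≢ j κ i i≢j)))
    (coeff-weight-yes κ (content κ) (λ _ → ≡.refl))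

  coeff-weight-no : ∀ {m} (κ : Vec (Fin n) m) a → ¬ (∀ i → content κ i ≡ a i) → coeff n (weight κ) a ≡ 0ℤ
  coeff-weight-no []      a p = coeff-1-nonzero n p
  coeff-weight-no (j ∷ κ) a p with a j in eq
  ... | zero  = coeff-generic-zero n j (weight κ) a eq
  ... | suc l = ≡.trans
    (coeff-generic-suc n j (weight κ) a b (≡.trans eq (≡.cong suc (≡.sym b-≡))) (λ i i≢j → ≡.sym (b-≢ i i≢j)))
    (coeff-weight-no κ b λ q → p λ i → matches q i (i Fin.≟ j))
    where
    b : Fin n → ℕ
    -- The exponents `a` with entry `j` lowered from `suc l` to `l`.
    b i = if does (i Fin.≟ j) then l else a i

    b-≡ : b j ≡ l
    b-≡ rewrite dec-true (j Fin.≟ j) ≡.refl = ≡.refl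

    b-≢ : ∀ i → i ≢ j → b i ≡ a i
    b-≢ i i≢j rewrite dec-false (i Fin.≟ j) i≢j = ≡.refl

    matches : (∀ i → content κ i ≡ b i) → ∀ i → Dec (i ≡ j) → content (j ∷ κ) i ≡ a i
    matches q i (yes ≡.refl) = ≡.trans (content-∷-≡ j κ) (≡.trans (≡.cong suc (≡.trans (q j) b-≡)) (≡.sym eq))
    matches q i (no i≢j)     = ≡.trans (content-∷-≢ j κ i i≢j) (≡.trans (q i) (b-≢ i i≢j))

length-filter : ∀ {X : Set} {P : X → Set} (P? : ∀ x → Dec (P x)) xs →
  + length (filter P? xs) ≡ sumℤ (map (λ x → if does (P? x) then 1ℤ else 0ℤ) xs)
length-filter P? []       = ≡.refl
length-filter P? (x ∷ xs) with does (P? x)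
... | true  = ≡.cong (ℤ._+_ 1ℤ) (length-filter P? xs)
... | false = ≡.trans (length-filter P? xs) (≡.sym (ℤ.+-identityˡ _))

indicator : ∀ {P : Set} {z} (P? : Dec P) → (P → z ≡ 1ℤ) → (¬ P → z ≡ 0ℤ) → (if does P? then 1ℤ else 0ℤ) ≡ z
indicator (yes p) y n = ≡.sym (y p)
indicator (no ¬p) y n = ≡.sym (n ¬p)

starSeries : ℕ → ℕ → ℕ → ∀ n → ℤAlgebra.Carrier (powerSeries n)
starSeries a b c n = Elementary.Walks.star (powerSeries n) (generic n) a b c

chromatic-coeff : ∀ a b c α →
  chromatic (spider a b c) α ≡ coeff (length α) (starSeries a b c (length α)) (lookup α)
chromatic-coeff a b c α = ≡.trans (length-filter _ κs) (≡.trans (∑ℤ-cong term κs)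
  (≡.trans (≡.sym (coeff-∑ n (λ κ → guard (does (proper? G κ)) (weight κ)) κs (lookup α)))
    (coeff-cong n (SpiderSum.∑-spider (powerSeries n) (generic n) a b c) (λ _ → ≡.refl))))
  where
  n  = length α
  G  = spider a b c
  κs = colourings n (suc (a + (b + c)))
  open ColouringSum (powerSeries n) (generic n)

  term : ∀ κ → (if does (proper? G κ ×-dec hasContent? G α κ) then 1ℤ else 0ℤ) ≡
    coeff n (guard (does (proper? G κ)) (weight κ)) (lookup α)
  term κ with does (proper? G κ)
  ... | false = ≡.sym (coeff-0 n (lookup α))
  ... | true  = indicator (hasContent? G α κ) (coeff-weight-yes κ (lookup α)) (coeff-weight-no κ (lookup α))

-- The coefficient of `chromatic` at `α` counts colourings with `length α` colours, one for each
-- variable of the ring in which `starSeries` is compared.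
embed-spider : ∀ a b c n → ℤAlgebra._≃_ (powerSeries n) (embed n (chromatic (spider a b c))) (starSeries a b c n)
embed-spider a b c = coeff-injective (λ n → embed n (chromatic (spider a b c))) (starSeries a b c)
  (λ α → ≡.trans (coeff-embed (chromatic (spider a b c)) α) (chromatic-coeff a b c α))

-- The expansion of the chromatic symmetric function of a spider

antidiagonalExpr : (ℕ → Expr) → (ℕ → Expr) → ℕ → Expr
antidiagonalExpr f g zero    = f 0 ∗ g 0
antidiagonalExpr f g (suc n) = f 0 ∗ g (suc n) ⊹ antidiagonalExpr (f ∘ suc) g n

antidiagonalExpr-cong : ∀ f {g h} n → (∀ i → i ≤ n → g i ≡ h i) → antidiagonalExpr f g n ≡ antidiagonalExpr f h n
antidiagonalExpr-cong f zero    p = ≡.cong (f 0 ∗_) (p 0 z≤n)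
antidiagonalExpr-cong f (suc n) p = ≡.cong₂ _⊹_ (≡.cong (f 0 ∗_) (p (suc n) ℕ.≤-refl))
  (antidiagonalExpr-cong (f ∘ suc) n (λ i i≤n → p i (ℕ.m≤n⇒m≤1+n i≤n)))

-- The term (k - 1) eₖ of `path-rec`, with k = j + 1.
weightedVar : ℕ → Expr
weightedVar j = con (+ j) ∗ var (suc j)

-- The first argument bounds the recursion depth.
pathExprWithin : ℕ → ℕ → Expr
pathExprWithin d       zero    = con 1ℤ
pathExprWithin zero    (suc m) = con 0ℤ
pathExprWithin (suc d) (suc m) = var (suc m) ⊹ antidiagonalExpr weightedVar (pathExprWithin d) m

pathExpr : ℕ → Expr
pathExpr m = pathExprWithin m m

pathExprWithin-≤ : ∀ d m → m ≤ d → pathExprWithin d m ≡ pathExpr m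
pathExprWithin-≤ d m m≤d = go d m m m≤d ℕ.≤-refl
  where
  go : ∀ d d′ m → m ≤ d → m ≤ d′ → pathExprWithin d m ≡ pathExprWithin d′ m
  go d       d′       zero    p       q       = ≡.refl
  go (suc d) (suc d′) (suc m) (s≤s p) (s≤s q) = ≡.cong (var (suc m) ⊹_)
    (antidiagonalExpr-cong weightedVar m (λ i i≤m → go d d′ i (ℕ.≤-trans i≤m p) (ℕ.≤-trans i≤m q)))

pathExpr-suc : ∀ m → pathExpr (suc m) ≡ var (suc m) ⊹ antidiagonalExpr weightedVar pathExpr m
pathExpr-suc m = ≡.cong (var (suc m) ⊹_) (antidiagonalExpr-cong weightedVar m (pathExprWithin-≤ m))

-- `star-rec` solved for S(a, b, c+1): vertices move one at a time from the third leg to the second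
-- until a path remains.
starExpr : ℕ → ℕ → ℕ → Expr
starExpr a b zero    = pathExpr (suc (a + b))
starExpr a b (suc c) = starExpr a (suc b) c ⊹ pathExpr (suc (a + b)) ∗ pathExpr (suc c)
  ⊹ neg (pathExpr (suc (a + c)) ∗ pathExpr (suc b))

module PathEvaluation (A : ℤAlgebra) (ε : ℕ → ℤAlgebra.Carrier A) where
  open ℤAlgebra A renaming (_+_ to _⊞_; _*_ to _·_)
  open PowerSeries A using (_⊗_; Seq; tail)
  open Evaluation A ε

  eval-antidiagonal : ∀ f g n → eval (antidiagonalExpr f g n) ≃ ((eval ∘ f) ⊗ (eval ∘ g)) n
  eval-antidiagonal f g zero    = refl
  eval-antidiagonal f g (suc n) = +-congˡ (eval-antidiagonal (f ∘ suc) g n)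

  eval-path-suc : ∀ m → eval (pathExpr (suc m)) ≃ ε (suc m) ⊞ ((λ j → ι (+ j) · ε (suc j)) ⊗ (eval ∘ pathExpr)) m
  eval-path-suc m = trans (reflexive (≡.cong eval (pathExpr-suc m)))
    (+-congˡ (eval-antidiagonal weightedVar pathExpr m))

  ⊗-congʳ-≤ : ∀ (f : Seq) {g h : Seq} n → (∀ i → i ≤ n → g i ≃ h i) → (f ⊗ g) n ≃ (f ⊗ h) n
  ⊗-congʳ-≤ f zero    p = *-congˡ (p 0 z≤n)
  ⊗-congʳ-≤ f (suc n) p = +-cong (*-congˡ (p (suc n) ℕ.≤-refl))
    (⊗-congʳ-≤ (tail f) n (λ i i≤n → p i (ℕ.m≤n⇒m≤1+n i≤n)))

module _ (n : ℕ) where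
  open ℤAlgebra (powerSeries n) renaming (_+_ to _⊞_; _*_ to _·_)
  open PathEvaluation (powerSeries n) (genericElem n)
  open Evaluation (powerSeries n) (genericElem n)
  open Elementary.Walks (powerSeries n) (generic n)

  eval-path : ∀ m → eval (pathExpr m) ≃ path m
  eval-path m = below m m ℕ.≤-refl
    where
    below : ∀ d m → m ≤ d → eval (pathExpr m) ≃ path m
    below d       zero    _         = ι-1
    below (suc d) (suc m) (s≤s m≤d) = trans (eval-path-suc m)
      (trans (+-congˡ (⊗-congʳ-≤ _ m (λ i i≤m → below d i (ℕ.≤-trans i≤m m≤d)))) (sym (path-rec m)))

  eval-star : ∀ a b c → eval (starExpr a b c) ≃ star a b c
  eval-star a b zero    = trans (eval-path (suc (a + b))) (sym (star-0 a b))
  eval-star a b (suc c) = begin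
    eval (starExpr a (suc b) c) ⊞ eval (pathExpr (suc (a + b))) · eval (pathExpr (suc c))
      ⊞ - (eval (pathExpr (suc (a + c))) · eval (pathExpr (suc b)))
      ≈⟨ +-cong (+-cong (eval-star a (suc b) c) (*-cong (eval-path (suc (a + b))) (eval-path (suc c))))
           (-‿cong (*-cong (eval-path (suc (a + c))) (eval-path (suc b)))) ⟩
    star a (suc b) c ⊞ path (suc (a + b)) · path (suc c) ⊞ - Q
      ≈⟨ +-congʳ (star-rec a b c) ⟨
    star a b (suc c) ⊞ Q ⊞ - Q
      ≈⟨ trans (+-assoc _ _ _) (trans (+-congˡ (-‿inverseʳ Q)) (+-identityʳ _)) ⟩
    star a b (suc c) ∎
    where Q = path (suc (a + c)) · path (suc b)

module _ {a b c : ℕ} (Λ : List (List ℕ)) (w : List ℕ → ℤ) (f≈ : chromatic (spider a b c) ≈ linComb Λ w) where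

  -- In n variables both expressions evaluate to the chromatic function, so their difference is a
  -- polynomial relation between the eₖ and `transfer` carries it to `ε`.
  expansion : ∀ n (A : ℤAlgebra) (let open ℤAlgebra A) (ε : ℕ → Carrier) → ε 0 ≃ 1# → (∀ k → n < k → ε k ≃ 0#) →
    Evaluation.eval A ε (linCombExpr Λ w) ≃ Evaluation.eval A ε (starExpr a b c)
  expansion n A ε ε-0 v = GroupProperties.x∙y⁻¹≈ε⇒x≈y +-group _ _
    (transfer n (linCombExpr Λ w ⊹ neg (starExpr a b c)) generic≈0 A ε ε-0 v)
    where
    open ℤAlgebra A
    module R = ℤAlgebra (powerSeries n)
    evalᴿ = Evaluation.eval (powerSeries n) (genericElem n)

    generic≈0 : evalᴿ (linCombExpr Λ w) R.+ R.- evalᴿ (starExpr a b c) R.≃ R.0#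
    generic≈0 = GroupProperties.x≈y⇒x∙y⁻¹≈ε R.+-group (R.begin
      evalᴿ (linCombExpr Λ w)           R.≈⟨ embed-linComb n Λ w ⟨
      embed n (linComb Λ w)             R.≈⟨ embed-cong n f≈ ⟨
      embed n (chromatic (spider a b c)) R.≈⟨ embed-spider a b c n ⟩
      starSeries a b c n                R.≈⟨ eval-star n a b c ⟨
      evalᴿ (starExpr a b c)            R.∎)

-- Substitution of power series with nonnegative coefficients

ℤ⟦t⟧ : ℤAlgebra
ℤ⟦t⟧ = powerSeries 1

open PowerSeries ℤ-algebra using (Seq; const; _⊗_; const-⊗; ⊗-zeroˡ; ⊗-cong; ⊗-comm; ⊗-distribʳ; ⊗-identityˡ; _⊕_)
open Elementary ℤ-algebra using (shift; shift-⊗-suc)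

NonNegative : Seq → Set
NonNegative f = ∀ n → 0ℤ ℤ.≤ f n

*-nonNegative : ∀ {x y} → 0ℤ ℤ.≤ x → 0ℤ ℤ.≤ y → 0ℤ ℤ.≤ x ℤ.* y
*-nonNegative {+ x} {+ y} p q = ≡.subst (0ℤ ℤ.≤_) (ℤ.pos-* x y) (ℤ.+≤+ z≤n)

⊗-nonNegative : ∀ {f g} → NonNegative f → NonNegative g → NonNegative (f ⊗ g)
⊗-nonNegative p q zero    = *-nonNegative (p 0) (q 0)
⊗-nonNegative p q (suc n) = ℤ.+-mono-≤ (*-nonNegative (p 0) (q (suc n))) (⊗-nonNegative (p ∘ suc) q n)

const-nonNegative : ∀ {z} → 0ℤ ℤ.≤ z → NonNegative (const z)
const-nonNegative p zero    = p
const-nonNegative p (suc n) = ℤ.≤-refl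

shift-nonNegative : ∀ {z} → 0ℤ ℤ.≤ z → NonNegative (shift z)
shift-nonNegative p zero    = ℤ.≤-refl
shift-nonNegative p (suc n) = const-nonNegative p n

module _ (ε : ℕ → Seq) (ε-nonNegative : ∀ k → NonNegative (ε k)) where
  open Evaluation ℤ⟦t⟧ ε

  monomial-nonNegative : ∀ μ → NonNegative (eval (monomialExpr μ))
  monomial-nonNegative []      = ε-nonNegative 0
  monomial-nonNegative (k ∷ μ) = ⊗-nonNegative (ε-nonNegative k) (monomial-nonNegative μ)

  linComb-nonNegative : ∀ Λ w → All (λ μ → 0ℤ ℤ.≤ w μ) Λ → NonNegative (eval (linCombExpr Λ w))
  linComb-nonNegative []      w _            = const-nonNegative ℤ.≤-refl
  linComb-nonNegative (μ ∷ Λ) w (p All.∷ ps) n = ℤ.+-mono-≤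
    (⊗-nonNegative (const-nonNegative p) (monomial-nonNegative μ) n) (linComb-nonNegative Λ w ps n)

  ePositive⇒nonNegative : ∀ {a b c} → EPositive (chromatic (spider a b c)) → ∀ n →
    (∀ m → ε 0 m ≡ const 1ℤ m) → (∀ k → n < k → ∀ m → ε k m ≡ 0ℤ) → NonNegative (eval (starExpr a b c))
  ePositive⇒nonNegative (Λ , w , _ , _ , w≥0 , f≈) n ε-0 v m =
    ≡.subst (0ℤ ℤ.≤_) (expansion Λ w f≈ n ℤ⟦t⟧ ε ε-0 v m) (linComb-nonNegative Λ w w≥0 m)

-- The substitution e₂ = 1, e₃ = t

double : ℕ → ℕ
double zero    = zero
double (suc n) = suc (suc (double n))

double-+ : ∀ m n → double (m + n) ≡ double m + double n
double-+ zero    n = ≡.refl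
double-+ (suc m) n = ≡.cong (_+_ 2) (double-+ m n)

odd+odd : ∀ m n → suc (double m) + suc (double n) ≡ double (suc (m + n))
odd+odd m n = ≡.trans (≡.cong (_+_ 1) (ℕ.+-suc (double m) (double n))) (≡.cong (_+_ 2) (≡.sym (double-+ m n)))

module ThreeParts where

  ε : ℕ → Seq
  ε 0 = const 1ℤ
  ε 1 = λ _ → 0ℤ
  ε 2 = const 1ℤ
  ε 3 = shift 1ℤ
  ε (suc (suc (suc (suc k)))) = λ _ → 0ℤ

  open Evaluation ℤ⟦t⟧ ε
  open PathEvaluation ℤ⟦t⟧ ε
  module B = PowerSeries ℤ⟦t⟧
  module T = ℤAlgebra ℤ⟦t⟧

  ε-nonNegative : ∀ k → NonNegative (ε k)
  ε-nonNegative 0 = const-nonNegative (ℤ.+≤+ z≤n)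
  ε-nonNegative 1 _ = ℤ.≤-refl
  ε-nonNegative 2 = const-nonNegative (ℤ.+≤+ z≤n)
  ε-nonNegative 3 = shift-nonNegative (ℤ.+≤+ z≤n)
  ε-nonNegative (suc (suc (suc (suc k)))) _ = ℤ.≤-refl

  ε-vanish : ∀ k → 3 < k → ∀ m → ε k m ≡ 0ℤ
  ε-vanish (suc (suc (suc (suc k)))) _ m = ≡.refl
  ε-vanish 1 (s≤s ()) m
  ε-vanish 2 (s≤s (s≤s ())) m
  ε-vanish 3 (s≤s (s≤s (s≤s ()))) m

  abstract
    p : ℕ → Seq
    p m = eval (pathExpr m)

    S : ℕ → ℕ → ℕ → Seq
    S a b c = eval (starExpr a b c)

    S≡ : ∀ a b c m → eval (starExpr a b c) m ≡ S a b c m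
    S≡ a b c m = ≡.refl

    p-1-0 : p 1 0 ≡ 0ℤ
    p-1-0 = ≡.refl
    p-1-1 : p 1 1 ≡ 0ℤ
    p-1-1 = ≡.refl
    p-2-0 : p 2 0 ≡ + 2
    p-2-0 = ≡.refl
    p-3-0 : p 3 0 ≡ 0ℤ
    p-3-0 = ≡.refl
    p-3-1 : p 3 1 ≡ + 3
    p-3-1 = ≡.refl

    -- As eₖ = 0 for k ≥ 4, only the factors 0 e₁, 1 e₂ and 2 e₃ survive in the path recursion; with
    -- the values inserted it reads Pₘ₊₄ = Pₘ₊₂ + 2t Pₘ₊₁.
    p-rec : ∀ m k → p (4 + m) k ≡
      ((const 0ℤ ⊗ ε 1) ⊗ p (3 + m)) k ℤ.+ (((const 1ℤ ⊗ ε 2) ⊗ p (2 + m)) k ℤ.+ ((const (+ 2) ⊗ ε 3) ⊗ p (1 + m)) k)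
    p-rec m k = ≡.trans (eval-path-suc (3 + m) k) (≡.trans (ℤ.+-identityˡ _)
      (≡.cong (ℤ._+_ (((const 0ℤ ⊗ ε 1) ⊗ p (3 + m)) k)) (≡.cong (ℤ._+_ (((const 1ℤ ⊗ ε 2) ⊗ p (2 + m)) k))
        (≡.trans (≡.cong (ℤ._+_ (((const (+ 2) ⊗ ε 3) ⊗ p (1 + m)) k))
          (B.⊗-zeroˡ (eval ∘ pathExpr) (λ j → T.zeroʳ (const (+ (3 + j)))) m k)) (ℤ.+-identityʳ _)))))

    S-0 : ∀ a b m → S a b 0 m ≡ p (suc (a + b)) m
    S-0 a b m = ≡.refl

    S-suc-0 : ∀ a b c {q r s t} → p (suc (a + b)) 0 ≡ q → p (suc c) 0 ≡ r → p (suc (a + c)) 0 ≡ s → p (suc b) 0 ≡ t →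
      S a b (suc c) 0 ≡ S a (suc b) c 0 ℤ.+ q ℤ.* r ℤ.+ ℤ.- (s ℤ.* t)
    S-suc-0 a b c ≡.refl ≡.refl ≡.refl ≡.refl = ≡.refl

    S-suc-1 : ∀ a b c {q r s t q′ r′ s′ t′} →
      p (suc (a + b)) 0 ≡ q → p (suc c) 0 ≡ r → p (suc (a + c)) 0 ≡ s → p (suc b) 0 ≡ t →
      p (suc (a + b)) 1 ≡ q′ → p (suc c) 1 ≡ r′ → p (suc (a + c)) 1 ≡ s′ → p (suc b) 1 ≡ t′ →
      S a b (suc c) 1 ≡ S a (suc b) c 1 ℤ.+ (q ℤ.* r′ ℤ.+ q′ ℤ.* r) ℤ.+ ℤ.- (s ℤ.* t′ ℤ.+ s′ ℤ.* t)
    S-suc-1 a b c ≡.refl ≡.refl ≡.refl ≡.refl ≡.refl ≡.refl ≡.refl ≡.refl = ≡.refl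

  p-rec-0 : ∀ m → p (4 + m) 0 ≡ p (2 + m) 0
  p-rec-0 m = ≡.trans (p-rec m 0) (solve 3 (λ x y z → con 0ℤ :* x :+ (con 1ℤ :* y :+ con 0ℤ :* z) := y) ≡.refl
    (p (3 + m) 0) (p (2 + m) 0) (p (1 + m) 0))
    where open +-*-Solver

  p-rec-1 : ∀ m → p (4 + m) 1 ≡ p (2 + m) 1 ℤ.+ + 2 ℤ.* p (1 + m) 0
  p-rec-1 m = ≡.trans (p-rec m 1) (solve 6 (λ x x′ y y′ z z′ →
      (con 0ℤ :* x′ :+ con 0ℤ :* x) :+ ((con 1ℤ :* y′ :+ con 0ℤ :* y) :+ (con 0ℤ :* z′ :+ con (+ 2) :* z)) := y′ :+ con (+ 2) :* z) ≡.refl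
    (p (3 + m) 0) (p (3 + m) 1) (p (2 + m) 0) (p (2 + m) 1) (p (1 + m) 0) (p (1 + m) 1))
    where open +-*-Solver

  -- At t = 0 the path series is (1 + z²) / (1 - z²) = 1 + 2z² + 2z⁴ + ⋯.
  p-odd-0 : ∀ j → p (suc (double j)) 0 ≡ 0ℤ
  p-odd-0 zero          = p-1-0
  p-odd-0 (suc zero)    = p-3-0
  p-odd-0 (suc (suc j)) = ≡.trans (p-rec-0 (suc (double j))) (p-odd-0 (suc j))

  p-even-0 : ∀ j → p (2 + double j) 0 ≡ + 2
  p-even-0 zero    = p-2-0
  p-even-0 (suc j) = ≡.trans (p-rec-0 (double j)) (p-even-0 j)

  -- The start is P₃ = 3e₃ + e₂e₁; each step adds twice the constant term 2 of an even path.
  p-odd-1 : ∀ j → p (3 + double j) 1 ≡ + 3 ℤ.+ + 4 ℤ.* + j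
  p-odd-1 zero    = p-3-1
  p-odd-1 (suc j) = ≡.trans (p-rec-1 (suc (double j)))
    (≡.trans (≡.cong₂ (λ x y → x ℤ.+ + 2 ℤ.* y) (p-odd-1 j) (p-even-0 j))
      (solve 1 (λ j → (con (+ 3) :+ con (+ 4) :* j) :+ con (+ 2) :* con (+ 2) := con (+ 3) :+ con (+ 4) :* (con 1ℤ :+ j)) ≡.refl (+ j)))
    where open +-*-Solver

  private
    at : ∀ {f : ℕ → Seq} {m n k x} → m ≡ n → f n k ≡ x → f m k ≡ x
    at ≡.refl q = q

    index₁ : ∀ α β → suc (suc (double α) + suc (double β)) ≡ suc (double (suc (α + β)))
    index₁ α β = ≡.cong (_+_ 1) (odd+odd α β)

    index₂ : ∀ α β → suc (double α + suc (double β)) ≡ 2 + double (α + β)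
    index₂ α β = ≡.trans (≡.cong (_+_ 1) (ℕ.+-suc (double α) (double β))) (≡.cong (_+_ 2) (≡.sym (double-+ α β)))

    index₃ : ∀ α β → suc (double α + double β) ≡ suc (double (α + β))
    index₃ α β = ≡.cong (_+_ 1) (≡.sym (double-+ α β))

    index₄ : ∀ α β → suc (suc (double α) + double β) ≡ 2 + double (α + β)
    index₄ α β = ≡.cong (_+_ 2) (≡.sym (double-+ α β))

  -- Only products of two even paths have a nonzero constant term, namely 4. For c = 1 the value is
  -- 2 - 4. For larger c two steps of the recursion subtract 4 and add 4, which moves two vertices
  -- from the third leg to the second at no cost.
  star-odd : ∀ α β γ → S (suc (double α)) (suc (double β)) (suc (double γ)) 0 ≡ ℤ.- + 2
  star-odd α β zero = ≡.trans
    (S-suc-0 a b 0 ≡.refl p-1-0 (at {p} (index₄ α 0) (p-even-0 (α + 0))) (p-even-0 β))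
    (≡.trans (≡.cong (λ x → x ℤ.+ p (suc (a + b)) 0 ℤ.* 0ℤ ℤ.+ ℤ.- (+ 2 ℤ.* + 2))
        (≡.trans (S-0 a (suc b) 0) (at {p} (index₄ α (suc β)) (p-even-0 (α + suc β)))))
      (solve 1 (λ y → con (+ 2) :+ y :* con 0ℤ :+ :- (con (+ 2) :* con (+ 2)) := :- con (+ 2)) ≡.refl (p (suc (a + b)) 0)))
    where
    open +-*-Solver
    a = suc (double α)
    b = suc (double β)
  star-odd α β (suc γ) = ≡.trans
    (S-suc-0 a b (2 + double γ) (at {p} (index₁ α β) (p-odd-0 (suc (α + β)))) (p-odd-0 (suc γ))
      (at {p} (index₄ α (suc γ)) (p-even-0 (α + suc γ))) (p-even-0 β))
    (≡.trans (≡.cong (λ x → x ℤ.+ 0ℤ ℤ.* 0ℤ ℤ.+ ℤ.- (+ 2 ℤ.* + 2)) (≡.trans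
      (S-suc-0 a (suc b) (suc (double γ)) (at {p} (index₄ α (suc β)) (p-even-0 (α + suc β))) (p-even-0 γ)
        (at {p} (index₁ α γ) (p-odd-0 (suc (α + γ)))) (p-odd-0 (suc β)))
      (≡.cong (λ x → x ℤ.+ + 2 ℤ.* + 2 ℤ.+ ℤ.- (0ℤ ℤ.* 0ℤ)) (star-odd α (suc β) γ)))) ≡.refl)
    where
    a = suc (double α)
    b = suc (double β)

  -- The number of vertices is odd, so each product pairs an odd path with an even one and its
  -- t-coefficient is twice that of the odd path. For c = 1 this gives 3 + 4(α + β + 1) - 2(3 + 4α);
  -- longer legs reduce to it two vertices at a time.
  star-even : ∀ α β γ → S (double (suc α)) (suc (double β)) (suc (double γ)) 1 ≡
    1ℤ ℤ.+ + 4 ℤ.* (+ β ℤ.+ + γ) ℤ.- + 4 ℤ.* + α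
  star-even α β zero = ≡.trans
    (S-suc-1 a b 0 {q = p (suc (a + b)) 0} {q′ = p (suc (a + b)) 1} {t′ = p (suc b) 1} ≡.refl p-1-0
      (at {p} (index₃ (suc α) 0) (p-odd-0 (suc α + 0))) (p-even-0 β)
      ≡.refl p-1-1 (at {p} (index₃ (suc α) 0) (p-odd-1 (α + 0))) ≡.refl)
    (≡.trans (≡.cong (λ x → x ℤ.+ (q ℤ.* 0ℤ ℤ.+ q′ ℤ.* 0ℤ) ℤ.+ ℤ.- (0ℤ ℤ.* t′ ℤ.+ (+ 3 ℤ.+ + 4 ℤ.* + (α + 0)) ℤ.* + 2))
        (≡.trans (S-0 a (suc b) 1) (at {p} (index₃ (suc α) (suc β)) (p-odd-1 (α + suc β)))))
      (solve 5 (λ α β q q′ t′ →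
        con (+ 3) :+ con (+ 4) :* (α :+ (con 1ℤ :+ β)) :+ (q :* con 0ℤ :+ q′ :* con 0ℤ)
          :+ :- (con 0ℤ :* t′ :+ (con (+ 3) :+ con (+ 4) :* (α :+ con 0ℤ)) :* con (+ 2))
        := con 1ℤ :+ con (+ 4) :* (β :+ con 0ℤ) :- con (+ 4) :* α) ≡.refl (+ α) (+ β) q q′ t′))
    where
    open +-*-Solver
    a = double (suc α)
    b = suc (double β)
    q = p (suc (a + b)) 0
    q′ = p (suc (a + b)) 1
    t′ = p (suc b) 1
  star-even α β (suc γ) = ≡.trans
    (S-suc-1 a b (2 + double γ) {q′ = q′} {t′ = t′}
      (at {p} (index₂ (suc α) β) (p-even-0 (suc α + β))) (p-odd-0 (suc γ))
      (at {p} (index₃ (suc α) (suc γ)) (p-odd-0 (suc α + suc γ))) (p-even-0 β)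
      ≡.refl (p-odd-1 γ) (at {p} (index₃ (suc α) (suc γ)) (p-odd-1 (α + suc γ))) ≡.refl)
    (≡.trans (≡.cong (λ x → x ℤ.+ (+ 2 ℤ.* (+ 3 ℤ.+ + 4 ℤ.* + γ) ℤ.+ q′ ℤ.* 0ℤ)
          ℤ.+ ℤ.- (0ℤ ℤ.* t′ ℤ.+ (+ 3 ℤ.+ + 4 ℤ.* + (α + suc γ)) ℤ.* + 2))
        (≡.trans
          (S-suc-1 a (suc b) (suc (double γ)) {r′ = r′} {s′ = s′}
            (at {p} (index₃ (suc α) (suc β)) (p-odd-0 (suc α + suc β))) (p-even-0 γ)
            (at {p} (index₂ (suc α) γ) (p-even-0 (suc α + γ))) (p-odd-0 (suc β))
            (at {p} (index₃ (suc α) (suc β)) (p-odd-1 (α + suc β))) ≡.refl ≡.refl (p-odd-1 β))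
          (≡.cong (λ x → x ℤ.+ (0ℤ ℤ.* r′ ℤ.+ (+ 3 ℤ.+ + 4 ℤ.* + (α + suc β)) ℤ.* + 2)
              ℤ.+ ℤ.- (+ 2 ℤ.* (+ 3 ℤ.+ + 4 ℤ.* + β) ℤ.+ s′ ℤ.* 0ℤ)) (star-even α (suc β) γ))))
      (solve 7 (λ α β γ q′ r′ s′ t′ →
        con 1ℤ :+ con (+ 4) :* ((con 1ℤ :+ β) :+ γ) :- con (+ 4) :* α
          :+ (con 0ℤ :* r′ :+ (con (+ 3) :+ con (+ 4) :* (α :+ (con 1ℤ :+ β))) :* con (+ 2))
          :+ :- (con (+ 2) :* (con (+ 3) :+ con (+ 4) :* β) :+ s′ :* con 0ℤ)
          :+ (con (+ 2) :* (con (+ 3) :+ con (+ 4) :* γ) :+ q′ :* con 0ℤ)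
          :+ :- (con 0ℤ :* t′ :+ (con (+ 3) :+ con (+ 4) :* (α :+ (con 1ℤ :+ γ))) :* con (+ 2))
        := con 1ℤ :+ con (+ 4) :* (β :+ (con 1ℤ :+ γ)) :- con (+ 4) :* α) ≡.refl (+ α) (+ β) (+ γ) q′ r′ s′ t′))
    where
    open +-*-Solver
    a = double (suc α)
    b = suc (double β)
    q′ = p (suc (a + b)) 1
    t′ = p (suc b) 1
    r′ = p (2 + double γ) 1
    s′ = p (suc (a + suc (double γ))) 1

  nonNegative : ∀ {a b c} → EPositive (chromatic (spider a b c)) → NonNegative (S a b c)
  nonNegative {a} {b} {c} pos m = ≡.subst (0ℤ ℤ.≤_) (S≡ a b c m)
    (ePositive⇒nonNegative ε ε-nonNegative {a} {b} {c} pos 3 (λ _ → ≡.refl) ε-vanish m)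

-- The substitution e_{a+1} = e_{b+c} = t

⊗-monomial : ∀ {h : Seq} d (g : Seq) m → (∀ j → j ≢ d → h j ≡ 0ℤ) → (h ⊗ g) (d + m) ≡ h d ℤ.* g m
⊗-monomial {h} zero g zero    z = ≡.refl
⊗-monomial {h} zero g (suc m) z = ≡.trans
  (≡.cong (ℤ._+_ (h 0 ℤ.* g (suc m))) (⊗-zeroˡ g (λ j → z (suc j) λ ()) m)) (ℤ.+-identityʳ _)
⊗-monomial {h} (suc d) g m z = ≡.trans
  (≡.cong₂ ℤ._+_ (≡.cong (ℤ._* g (suc (d + m))) (z 0 λ ())) (⊗-monomial d g m (λ j j≢d → z (suc j) (j≢d ∘ ℕ.suc-injective))))
  (ℤ.+-identityˡ _)

module TwoParts (a v′ : ℕ) (a<v′ : a < v′) where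

  u v : ℕ
  u = suc a
  v = suc v′

  δ : ℕ → ℕ → ℤ
  δ k j = if does (k ℕ.≟ j) then 1ℤ else 0ℤ

  δ-≡ : ∀ k → δ k k ≡ 1ℤ
  δ-≡ k rewrite dec-true (k ℕ.≟ k) ≡.refl = ≡.refl

  δ-≢ : ∀ {k j} → k ≢ j → δ k j ≡ 0ℤ
  δ-≢ {k} {j} k≢j rewrite dec-false (k ℕ.≟ j) k≢j = ≡.refl

  δ-nonNegative : ∀ k j → 0ℤ ℤ.≤ δ k j
  δ-nonNegative k j with does (k ℕ.≟ j)
  ... | true  = ℤ.+≤+ z≤n
  ... | false = ℤ.≤-refl

  w : ℕ → ℤ
  w k = δ u k ℤ.+ δ v k

  u≢v : u ≢ v
  u≢v = ℕ.<⇒≢ (s≤s a<v′)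

  w-u : w u ≡ 1ℤ
  w-u = ≡.cong₂ ℤ._+_ (δ-≡ u) (δ-≢ (u≢v ∘ ≡.sym))

  w-v : w v ≡ 1ℤ
  w-v = ≡.cong₂ ℤ._+_ (δ-≢ u≢v) (δ-≡ v)

  w-small : ∀ {k} → k < u → w k ≡ 0ℤ
  w-small k<u = ≡.cong₂ ℤ._+_ (δ-≢ (ℕ.<⇒≢ k<u ∘ ≡.sym)) (δ-≢ (ℕ.<⇒≢ (ℕ.<-trans k<u (s≤s a<v′)) ∘ ≡.sym))

  w-large : ∀ {k} → v < k → w k ≡ 0ℤ
  w-large v<k = ≡.cong₂ ℤ._+_ (δ-≢ (ℕ.<⇒≢ (ℕ.<-trans (s≤s a<v′) v<k))) (δ-≢ (ℕ.<⇒≢ v<k))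

  w-nonNegative : ∀ k → 0ℤ ℤ.≤ w k
  w-nonNegative k = ℤ.+-mono-≤ (δ-nonNegative u k) (δ-nonNegative v k)

  ε : ℕ → Seq
  ε zero    = const 1ℤ
  ε (suc k) = shift (w (suc k))

  open Evaluation ℤ⟦t⟧ ε
  open PathEvaluation ℤ⟦t⟧ ε
  module B = PowerSeries ℤ⟦t⟧

  ε-nonNegative : ∀ k → NonNegative (ε k)
  ε-nonNegative zero    = const-nonNegative (ℤ.+≤+ z≤n)
  ε-nonNegative (suc k) = shift-nonNegative (w-nonNegative (suc k))

  ε-vanish : ∀ k → v < k → ∀ m → ε k m ≡ 0ℤ
  ε-vanish (suc k) v<k zero          = ≡.refl
  ε-vanish (suc k) v<k (suc zero)    = w-large v<k
  ε-vanish (suc k) v<k (suc (suc m)) = ≡.refl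

  f : ℕ → ℤ
  f j = + j ℤ.* w (suc j)

  scaled-shift : ∀ j n → (const (+ j) ⊗ ε (suc j)) n ≡ shift (f j) n
  scaled-shift j zero          = ℤ.*-zeroʳ (+ j)
  scaled-shift j (suc zero)    = const-⊗ (+ j) (ε (suc j)) 1
  scaled-shift j (suc (suc n)) = ≡.trans (const-⊗ (+ j) (ε (suc j)) (suc (suc n))) (ℤ.*-zeroʳ (+ j))

  ⊗-shift-zero : ∀ (f : ℕ → ℤ) g m → ((λ j → shift (f j)) B.⊗ g) m 0 ≡ 0ℤ
  ⊗-shift-zero f g zero    = ≡.refl
  ⊗-shift-zero f g (suc m) = ≡.trans (ℤ.+-identityˡ _) (⊗-shift-zero (f ∘ suc) g m)

  -- The first factor is t times a series with integer coefficients, so the path recursion expresses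
  -- each t-coefficient through the preceding one.
  ⊗-shift-suc : ∀ (f : ℕ → ℤ) g m k → ((λ j → shift (f j)) B.⊗ g) m (suc k) ≡ (f ⊗ (λ i → g i k)) m
  ⊗-shift-suc f g zero    k = shift-⊗-suc (f 0) (g 0) k
  ⊗-shift-suc f g (suc m) k = ≡.cong₂ ℤ._+_ (shift-⊗-suc (f 0) (g (suc m)) k) (⊗-shift-suc (f ∘ suc) g m k)

  abstract
    p : ℕ → Seq
    p m = eval (pathExpr m)

    S : ℕ → ℕ → Seq
    S b c = eval (starExpr a b c)

    S≡ : ∀ b c m → eval (starExpr a b c) m ≡ S b c m
    S≡ b c m = ≡.refl

    p-0 : ∀ k → p 0 k ≡ const 1ℤ k
    p-0 k = ≡.refl

    p-suc : ∀ m k → p (suc m) k ≡ shift (w (suc m)) k ℤ.+ ((λ j → shift (f j)) B.⊗ p) m k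
    p-suc m k = ≡.trans (eval-path-suc m k)
      (≡.cong (ℤ._+_ (shift (w (suc m)) k)) (B.⊗-cong {g = p} scaled-shift (λ _ _ → ≡.refl) m k))

    S-0 : ∀ b m → S b 0 m ≡ p (suc (a + b)) m
    S-0 b m = ≡.refl

    S-suc : ∀ b c → S b (suc c) 2 ≡
      S (suc b) c 2 ℤ.+ (p (suc (a + b)) ⊗ p (suc c)) 2 ℤ.+ ℤ.- (p (suc (a + c)) ⊗ p (suc b)) 2
    S-suc b c = ≡.refl

  p-suc-0 : ∀ m → p (suc m) 0 ≡ 0ℤ
  p-suc-0 m = ≡.trans (p-suc m 0) (≡.trans (ℤ.+-identityˡ _) (⊗-shift-zero f p m))

  scaled : ℕ → ℤ
  scaled k = + k ℤ.* w k

  scaled-u : scaled u ≡ + u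
  scaled-u = ≡.trans (≡.cong (ℤ._*_ (+ u)) w-u) (ℤ.*-identityʳ (+ u))

  scaled-v : scaled v ≡ + v
  scaled-v = ≡.trans (≡.cong (ℤ._*_ (+ v)) w-v) (ℤ.*-identityʳ (+ v))

  -- The coefficient of eₘ in Pₘ is m: the leading term contributes 1, the term (m - 1) eₘ P₀ the
  -- rest.
  p-1 : ∀ m → p m 1 ≡ scaled m
  p-1 zero    = p-0 1
  p-1 (suc m) = begin
    p (suc m) 1                                        ≡⟨ p-suc m 1 ⟩
    w (suc m) ℤ.+ ((λ j → shift (f j)) B.⊗ p) m 1      ≡⟨ ≡.cong (ℤ._+_ (w (suc m))) (⊗-shift-suc f p m 0) ⟩
    w (suc m) ℤ.+ (f ⊗ (λ i → p i 0)) m                ≡⟨ ≡.cong (ℤ._+_ (w (suc m))) (⊗-cong {f = f} (λ _ → ≡.refl) unit m) ⟩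
    w (suc m) ℤ.+ (f ⊗ const 1ℤ) m                     ≡⟨ ≡.cong (ℤ._+_ (w (suc m))) (≡.trans (⊗-comm f (const 1ℤ) m) (⊗-identityˡ f m)) ⟩
    w (suc m) ℤ.+ f m                                  ≡⟨ solve 2 (λ m w → w :+ m :* w := (con 1ℤ :+ m) :* w) ≡.refl (+ m) (w (suc m)) ⟩
    + suc m ℤ.* w (suc m)                              ∎
    where
    open ≡.≡-Reasoning
    open +-*-Solver
    unit : ∀ i → p i 0 ≡ const 1ℤ i
    unit zero    = p-0 0
    unit (suc i) = p-suc-0 i

  -- The product `e_u e_v` arises in two ways, from (u - 1) `e_u P_v` and from (v - 1) `e_v P_u`,
  -- and the linear terms of `P_v` and `P_u` are v and u.
  p-2 : p (u + v) 2 ≡ + a ℤ.* + v ℤ.+ + v′ ℤ.* + u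
  p-2 = begin
    p (suc (a + v)) 2                                  ≡⟨ p-suc (a + v) 2 ⟩
    0ℤ ℤ.+ ((λ j → shift (f j)) B.⊗ p) (a + v) 2       ≡⟨ ≡.trans (ℤ.+-identityˡ _) (⊗-shift-suc f p (a + v) 1) ⟩
    (f ⊗ (λ i → p i 1)) (a + v)                        ≡⟨ ⊗-cong (λ j → ℤ.*-distribˡ-+ (+ j) (δ u (suc j)) (δ v (suc j))) p-1 (a + v) ⟩
    ((part u ⊕ part v) ⊗ scaled) (a + v)               ≡⟨ ⊗-distribʳ scaled (part u) (part v) (a + v) ⟩
    (part u ⊗ scaled) (a + v) ℤ.+ (part v ⊗ scaled) (a + v)
      ≡⟨ ≡.cong₂ ℤ._+_ (⊗-monomial a scaled v (part-zero a))
           (≡.trans (≡.cong (part v ⊗ scaled) a+v≡v′+u) (⊗-monomial v′ scaled u (part-zero v′))) ⟩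
    part u a ℤ.* scaled v ℤ.+ part v v′ ℤ.* scaled u
      ≡⟨ ≡.cong₂ ℤ._+_ (≡.cong₂ (λ x y → (+ a ℤ.* x) ℤ.* (+ v ℤ.* y)) (δ-≡ u) w-v)
           (≡.cong₂ (λ x y → (+ v′ ℤ.* x) ℤ.* (+ u ℤ.* y)) (δ-≡ v) w-u) ⟩
    (+ a ℤ.* 1ℤ) ℤ.* (+ v ℤ.* 1ℤ) ℤ.+ (+ v′ ℤ.* 1ℤ) ℤ.* (+ u ℤ.* 1ℤ)
      ≡⟨ solve 4 (λ a v v′ u → (a :* con 1ℤ) :* (v :* con 1ℤ) :+ (v′ :* con 1ℤ) :* (u :* con 1ℤ) := a :* v :+ v′ :* u)
           ≡.refl (+ a) (+ v) (+ v′) (+ u) ⟩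
    + a ℤ.* + v ℤ.+ + v′ ℤ.* + u                       ∎
    where
    open ≡.≡-Reasoning
    open +-*-Solver
    -- `part k` is supported at k - 1 only; so the index a + v is read once as (u - 1) + v and once
    -- as (v - 1) + u.
    part : ℕ → Seq
    part k j = + j ℤ.* δ k (suc j)
    part-zero : ∀ d j → j ≢ d → part (suc d) j ≡ 0ℤ
    part-zero d j j≢d = ≡.trans (≡.cong (ℤ._*_ (+ j)) (δ-≢ (j≢d ∘ ≡.sym ∘ ℕ.suc-injective))) (ℤ.*-zeroʳ (+ j))
    a+v≡v′+u : a + v ≡ v′ + u
    a+v≡v′+u = ≡.trans (ℕ.+-suc a v′) (≡.trans (≡.cong (_+_ 1) (ℕ.+-comm a v′)) (≡.sym (ℕ.+-suc v′ a)))

  p⊗p : ∀ m n → (p (suc m) ⊗ p (suc n)) 2 ≡ scaled (suc m) ℤ.* scaled (suc n)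
  p⊗p m n = ≡.trans
    (≡.cong₂ (λ x y → x ℤ.* p (suc n) 2 ℤ.+ (p (suc m) 1 ℤ.* p (suc n) 1 ℤ.+ p (suc m) 2 ℤ.* y)) (p-suc-0 m) (p-suc-0 n))
    (≡.trans (solve 3 (λ x y z → con 0ℤ :* x :+ (y :+ z :* con 0ℤ) := y) ≡.refl
        (p (suc n) 2) (p (suc m) 1 ℤ.* p (suc n) 1) (p (suc m) 2))
      (≡.cong₂ ℤ._*_ (p-1 (suc m)) (p-1 (suc n))))
    where open +-*-Solver

  drop : ℕ → ℕ → ℤ
  drop b c = scaled (suc (a + c)) ℤ.* scaled (suc b)

  -- Since c + 1 < u < v, the path on c + 1 vertices has no term linear in t, so the added product
  -- does not reach t² and only the subtracted one remains.
  S-step : ∀ b c → c < a → S b (suc c) 2 ≡ S (suc b) c 2 ℤ.- drop b c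
  S-step b c c<a = ≡.trans (S-suc b c) (≡.cong₂ (λ x y → x ℤ.+ ℤ.- y)
    (≡.trans (≡.cong (ℤ._+_ (S (suc b) c 2)) (≡.trans (p⊗p (a + b) c)
        (≡.trans (≡.cong (λ x → scaled (suc (a + b)) ℤ.* (+ suc c ℤ.* x)) (w-small (s≤s c<a)))
          (solve 2 (λ x y → x :* (y :* con 0ℤ) := con 0ℤ) ≡.refl (scaled (suc (a + b))) (+ suc c)))))
      (ℤ.+-identityʳ (S (suc b) c 2)))
    (p⊗p (a + c) b))
    where open +-*-Solver

  drop-nonNegative : ∀ b c → 0ℤ ℤ.≤ drop b c
  drop-nonNegative b c = *-nonNegative
    (*-nonNegative {+ suc (a + c)} (ℤ.+≤+ z≤n) (w-nonNegative (suc (a + c)))) (*-nonNegative {+ suc b} (ℤ.+≤+ z≤n) (w-nonNegative (suc b)))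

  -- Repeated `S-step` with the nonnegative drops discarded; it bridges the stretches around the two
  -- steps whose drops are needed exactly.
  S-descent : ∀ k b c → k + c ≤ a → S b (k + c) 2 ℤ.≤ S (k + b) c 2
  S-descent zero    b c _     = ℤ.≤-refl
  S-descent (suc k) b c k+c<a = begin
    S b (suc (k + c)) 2                     ≡⟨ S-step b (k + c) k+c<a ⟩
    S (suc b) (k + c) 2 ℤ.- drop b (k + c)  ≤⟨ ℤ.+-monoʳ-≤ (S (suc b) (k + c) 2) (ℤ.neg-mono-≤ (drop-nonNegative b (k + c))) ⟩
    S (suc b) (k + c) 2 ℤ.+ 0ℤ              ≡⟨ ℤ.+-identityʳ _ ⟩
    S (suc b) (k + c) 2                     ≤⟨ S-descent k (suc b) c (ℕ.<⇒≤ k+c<a) ⟩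
    S (k + suc b) c 2                       ≡⟨ ≡.cong (λ j → S j c 2) (ℕ.+-suc k b) ⟩
    S (suc k + b) c 2                       ∎
    where open ℤ.≤-Reasoning

  drop-u : ∀ b c → suc b ≡ u → suc (a + c) ≡ v → drop b c ≡ + u ℤ.* + v
  drop-u b c p q = ≡.trans
    (≡.cong₂ ℤ._*_ (≡.trans (≡.cong scaled q) scaled-v) (≡.trans (≡.cong scaled p) scaled-u)) (ℤ.*-comm (+ v) (+ u))

  drop-v : ∀ b c → suc b ≡ v → suc (a + c) ≡ u → drop b c ≡ + u ℤ.* + v
  drop-v b c p q =
    ≡.cong₂ ℤ._*_ (≡.trans (≡.cong scaled q) scaled-u) (≡.trans (≡.cong scaled p) scaled-v)

  nonNegative : ∀ {b c} → EPositive (chromatic (spider a b c)) → NonNegative (S b c)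
  nonNegative {b} {c} pos m = ≡.subst (0ℤ ℤ.≤_) (S≡ b c m)
    (ePositive⇒nonNegative ε ε-nonNegative {a} {b} {c} pos v (λ _ → ≡.refl) ε-vanish m)

-- With a = k + b and c = k + 2 + l we have b + c = a + 2 + l.
star-negative : ∀ b k l → k + (2 + l) ≤ k + b → let open TwoParts (k + b) (suc (k + b + l)) (s≤s (ℕ.m≤m+n (k + b) l)) in
  S b (k + (2 + l)) 2 ℤ.< 0ℤ
star-negative b k l c≤a = begin-strict
  S b (k + (2 + l)) 2
    ≤⟨ S-descent k b (2 + l) c≤a ⟩
  S a (2 + l) 2
    -- The second leg has reached length `a`, so the subtracted product is `P_v P_u` and costs u v.
    ≡⟨ S-step a (suc l) (ℕ.≤-trans (ℕ.m≤n+m (2 + l) k) c≤a) ⟩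
  S u (1 + l) 2 ℤ.- drop a (suc l)
    ≡⟨ ≡.cong (λ x → S u (1 + l) 2 ℤ.- x) (drop-u a (suc l) ≡.refl (≡.cong (_+_ 1) (ℕ.+-suc a l))) ⟩
  S u (1 + l) 2 ℤ.- uv
    ≡⟨ ≡.cong (λ j → S u j 2 ℤ.- uv) (ℕ.+-comm 1 l) ⟩
  S u (l + 1) 2 ℤ.- uv
    ≤⟨ ℤ.+-monoˡ-≤ (ℤ.- uv) (S-descent l u 1 (ℕ.≤-trans (ℕ.≤-reflexive (ℕ.+-comm l 1)) 1+l≤a)) ⟩
  S (l + u) 1 2 ℤ.- uv
    -- When the last vertex of the third leg moves, the subtracted product is `P_u P_v` and costs u
    -- v again. This is a different step from the one above because the third leg then had length 2
    -- + l.
    ≡⟨ ≡.cong (ℤ._- uv) (S-step (l + u) 0 (ℕ.≤-trans (s≤s z≤n) 1+l≤a)) ⟩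
  S (suc (l + u)) 0 2 ℤ.- drop (l + u) 0 ℤ.- uv
    ≡⟨ ≡.cong₂ (λ x y → x ℤ.- y ℤ.- uv) (≡.trans (≡.cong (λ j → S j 0 2) l+u+1≡v) (≡.trans (S-0 v 2) p-2))
         (drop-v (l + u) 0 l+u+1≡v (≡.cong (_+_ 1) (ℕ.+-identityʳ a))) ⟩
  + a ℤ.* + v ℤ.+ + v′ ℤ.* + u ℤ.- uv ℤ.- uv
    -- The final path contributes 2uv - u - v, so after both drops -(u + v) is left.
    ≡⟨ solve 2 (λ a v′ → a :* (con 1ℤ :+ v′) :+ v′ :* (con 1ℤ :+ a) :- (con 1ℤ :+ a) :* (con 1ℤ :+ v′) :- (con 1ℤ :+ a) :* (con 1ℤ :+ v′)
         := :- (con (+ 2) :+ a :+ v′)) ≡.refl (+ a) (+ v′) ⟩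
  ℤ.- + (2 + a + v′)
    <⟨ ℤ.-<+ ⟩
  0ℤ ∎
  where
  a v′ : ℕ
  a  = k + b
  v′ = suc (k + b + l)
  open TwoParts a v′ (s≤s (ℕ.m≤m+n (k + b) l))
  open ℤ.≤-Reasoning
  open +-*-Solver using (solve; _:*_; _:+_; _:-_; :-_; con; _:=_)
  uv : ℤ
  uv = + u ℤ.* + v
  1+l≤a : 1 + l ≤ a
  1+l≤a = ℕ.≤-trans (ℕ.n≤1+n (1 + l)) (ℕ.≤-trans (ℕ.m≤n+m (2 + l) k) c≤a)
  l+u+1≡v : suc (l + u) ≡ v
  l+u+1≡v = ≡.cong (_+_ 1) (≡.trans (ℕ.+-suc l a) (≡.cong (_+_ 1) (ℕ.+-comm l a)))

-- Parity and the comparison of a with b + c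

even⊎odd : ∀ n → (∃[ j ] n ≡ double j) ⊎ (∃[ j ] n ≡ suc (double j))
even⊎odd zero          = inj₁ (0 , ≡.refl)
even⊎odd (suc zero)    = inj₂ (0 , ≡.refl)
even⊎odd (suc (suc n)) with even⊎odd n
... | inj₁ (j , ≡.refl) = inj₁ (suc j , ≡.refl)
... | inj₂ (j , ≡.refl) = inj₂ (suc j , ≡.refl)

odd : ∀ n → parity n ≡ 1ℙ → ∃[ j ] n ≡ suc (double j)
odd (suc zero)    p = 0 , ≡.refl
odd (suc (suc n)) p with odd n p
... | j , ≡.refl = suc j , ≡.refl

double-mono-≤ : ∀ {m n} → m ≤ n → double m ≤ double n
double-mono-≤ z≤n     = z≤n
double-mono-≤ (s≤s p) = s≤s (s≤s (double-mono-≤ p))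

¬ePositive-< : ∀ {a b c} → b ≤ a → c ≤ b → 2 + a ≤ b + c → ¬ EPositive (chromatic (spider a b c))
¬ePositive-< {a} {b} {c} b≤a c≤b 2+a≤b+c pos with ℕ.m≤n⇒∃[o]m+o≡n b≤a
... | k , ≡.refl with ℕ.m≤n⇒∃[o]m+o≡n (ℕ.+-cancelˡ-≤ b (k + 2) c (≡.subst (_≤ b + c) 2+b+k≡b+k+2 2+a≤b+c))
  where
  2+b+k≡b+k+2 : 2 + (b + k) ≡ b + (k + 2)
  2+b+k≡b+k+2 = ≡.trans (ℕ.+-comm 2 (b + k)) (ℕ.+-assoc b k 2)
... | l , ≡.refl rewrite ℕ.+-comm b k | ℕ.+-assoc k 2 l =
  ℤ.<⇒≱ (star-negative b k l (ℕ.≤-trans c≤b (ℕ.m≤n+m b k)))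
    (TwoParts.nonNegative (k + b) (suc (k + b + l)) (s≤s (ℕ.m≤m+n (k + b) l)) {b} {k + (2 + l)} pos 2)

theorem3p1 : (a b c : ℕ) → a ≥ b → b ≥ c → c ≥ 1 → parity b ≡ 1ℙ → parity c ≡ 1ℙ →
    EPositive (chromatic (spider a b c)) → a ≡ b + c
theorem3p1 a b c a≥b b≥c _ b-odd c-odd pos with odd b b-odd | odd c c-odd | even⊎odd a
... | β , ≡.refl | γ , ≡.refl | inj₂ (α , ≡.refl) =
  contradiction (≡.subst (0ℤ ℤ.≤_) (ThreeParts.star-odd α β γ) (ThreeParts.nonNegative {a} {b} {c} pos 0)) λ ()
-- Here a = 2α and b + c = 2(β + γ + 1), so halves are compared.
... | β , ≡.refl | γ , ≡.refl | inj₁ (α , ≡.refl) with ℕ.<-cmp α (suc (β + γ))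
... | tri≈ _ ≡.refl _ = ≡.sym (odd+odd β γ)
... | tri> _ _ (s≤s {n = α′} β+γ<α′) = contradiction
  (≡.subst (0ℤ ℤ.≤_) (ThreeParts.star-even α′ β γ) (ThreeParts.nonNegative {a} {b} {c} pos 1)) (ℤ.<⇒≱ negative)
  where
  negative : 1ℤ ℤ.+ + 4 ℤ.* (+ β ℤ.+ + γ) ℤ.- + 4 ℤ.* + α′ ℤ.< 0ℤ
  negative with ℕ.m≤n⇒∃[o]m+o≡n β+γ<α′
  -- With α′ = β + γ + 1 + o the t-coefficient is -(3 + 4o).
  ... | o , ≡.refl = ≡.subst (ℤ._< 0ℤ) (≡.sym (solve 3 (λ β γ o →
      con 1ℤ :+ con (+ 4) :* (β :+ γ) :- con (+ 4) :* (con 1ℤ :+ (β :+ γ) :+ o) := :- (con (+ 3) :+ con (+ 4) :* o)) ≡.refl (+ β) (+ γ) (+ o)))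
      (ℤ.neg-mono-< (ℤ.+-mono-<-≤ {0ℤ} {+ 3} (ℤ.+<+ (s≤s z≤n)) (*-nonNegative {+ 4} {+ o} (ℤ.+≤+ z≤n) (ℤ.+≤+ z≤n))))
    where open +-*-Solver
-- Both a and b + c are even, so a < b + c leaves a gap of at least 2, which makes u and v distinct.
... | tri< (s≤s α≤β+γ) _ _ = contradiction pos
  (¬ePositive-< a≥b b≥c (≡.subst (2 + double α ≤_) (≡.sym (odd+odd β γ)) (double-mono-≤ (s≤s α≤β+γ))))
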